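{- Given a Petri net $N=(S,T,m_0)$, a set of places $V\subseteq S$ and a place $p\in S$, it is decidable whether $N$ infinitely visits $V$ with mandatory place $p$.
   Context: A Petri net is a triple $N=(S,T,m_0)$ with $S$ a finite set of places, $T$ a finite set of transitions, and $m_0$ an initial marking, where a marking is a finite multiset over $S$ ($m(q)$ is the number of tokens in place $q$). A transition is a pair of markings written $m'\Rightarrow m''$; it can fire in marking $m$ if $m(q)\ge m'(q)$ for all $q\in S$, yielding the marking $(m\setminus m')\uplus m''$ (multiset difference and union); this is written $m\Rightarrow n$. $N$ infinitely visits $V$ with mandatory place $p$ if there exist an infinite sequence of firings $m_0\Rightarrow m_1\Rightarrow m_2\Rightarrow\cdots$ and an index $i$ such that for every $j\ge i$ there is a place $p_j\in V$ with $m_j(p_j)\ge1$, and moreover $m_j(p)\ge1$. -}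

module Defs where

open import Data.Nat using (ℕ; suc; _+_; _∸_; _≤_)
open import Data.Fin using (Fin)
open import Data.Fin.Subset using (Subset; _∈_)
open import Data.List using (List)
open import Data.List.Membership.Propositional renaming (_∈_ to _∈ˡ_)
open import Data.Product using (Σ; ∃; ∃-syntax; _×_)
open import Relation.Binary.PropositionalEquality using (_≡_)

-- Places of a net with n places are Fin n (S is a finite set).
-- A marking is a finite multiset over S: m q = number of tokens in place q.
Marking : ℕ → Set
Marking n = Fin n → ℕ

record Transition (n : ℕ) : Set where
  constructor _⇒_
  field
    pre  : Marking n
    post : Marking n
open Transition public

-- Petri net N = (S, T, m₀) with S = Fin n, T a finite set (given as a list).
record PetriNet (n : ℕ) : Set where
  constructor net
  field
    T  : List (Transition n)
    m₀ : Marking n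
open PetriNet public

Fires : ∀ {n} → Transition n → Marking n → Marking n → Set
Fires t m m' = (∀ q → pre t q ≤ m q) × (∀ q → m' q ≡ (m q ∸ pre t q) + post t q)

Step : ∀ {n} → PetriNet n → Marking n → Marking n → Set
Step N m m' = ∃[ t ] (t ∈ˡ T N × Fires t m m')

InfinitelyVisits : ∀ {n} → PetriNet n → Subset n → Fin n → Set
InfinitelyVisits {n} N V p =
  Σ (ℕ → Marking n) λ ms →
    (∀ q → ms 0 q ≡ m₀ N q) ×
    (∀ j → Step N (ms j) (ms (suc j))) ×
    ∃[ i ] (∀ j → i ≤ j →
      (∃[ pj ] (pj ∈ V × 1 ≤ ms j pj)) × 1 ≤ ms j p)

{-# OPTIONS --safe #-}
module Submission where

-- The safe markings (p and some place of V are marked) form an upward closed set.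
-- A Karp-Miller construction, whose termination rests on an inductive form of
-- Dickson's lemma, yields a finite set L of ω-markings that approximates the
-- reachable markings from above and whose members can all be approached by reachable
-- markings. Consider the finite graph on L with an edge for every firing
-- from a safe node, up to ⊑, weighted by its effect in ℤⁿ. An infinite run
-- that is eventually safe visits, by Dickson's lemma, the same node twice with
-- markings m ≤ m′, which is a closed walk of nonnegative weight; conversely such
-- a walk can be repeated forever from a sufficiently large reachable marking.
-- Whether it exists is decided by Kleene's algorithm, which computes the weights of
-- the closed walks as a semilinear set, and by Fourier-Motzkin elimination, which
-- decides for each linear component b + span P whether k b + span P, for some
-- k ≥ 1, contains a nonnegative vector. The factor k is harmless because closed walks
-- at a node can be concatenated.

open import Defs
open import Algebra.Bundles using (CommutativeMonoid)
import Algebra.Properties.CommutativeMonoid.Mult as Mult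
import Algebra.Solver.CommutativeMonoid
open import Data.Nat using (ℕ; zero; suc; _+_; _∸_; _⊔_; _≤_; _<_; z≤n; s≤s; _≤?_; _<?_)
open import Data.Nat.Properties
open import Data.Integer
  using (ℤ; 0ℤ; 1ℤ; +_; -[1+_]; -_; _⊖_; +≤+; -≤+; +<+)
  renaming (_+_ to _+ℤ_; _-_ to _-ℤ_; _*_ to _*ℤ_; ∣_∣ to ∣_∣ℤ;
            _≤_ to _≤ℤ_; _<_ to _<ℤ_; _≤?_ to _≤ℤ?_; _<?_ to _<ℤ?_)
import Data.Integer.Properties as ℤ
open import Data.Fin using (Fin; zero; suc; toℕ)
import Data.Fin.Properties as Fin
open import Data.Fin.Subset using (Subset; _∈_; _∉_; _∪_; ⁅_⁆; ⊥) renaming (∣_∣ to card)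
open import Data.Fin.Subset.Properties
  using (_∈?_; x∈⁅x⁆; x∈⁅y⁆⇒x≡y; p⊆p∪q; q⊆p∪q; x∈p∪q⁻; p⊂q⇒∣p∣<∣q∣; ∣p∣≤n; ∉⊥)
open import Data.List using (List; []; _∷_; _++_; map; filter; allFin; cartesianProductWith)
import Data.List as List
open import Data.List.Membership.Propositional using (find; lose) renaming (_∈_ to _∈ˡ_)
open import Data.List.Membership.Propositional.Properties
  using (∈-++⁺ˡ; ∈-++⁺ʳ; ∈-++⁻; ∈-map⁺; ∈-map⁻; ∈-filter⁺; ∈-filter⁻; ∈-allFin;
         ∈-cartesianProductWith⁺; ∈-cartesianProductWith⁻)
open import Data.List.Relation.Binary.Subset.Propositional using (_⊆_)
open import Data.List.Relation.Unary.All as All using (All; []; _∷_)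
import Data.List.Relation.Unary.All.Properties as All
open import Data.List.Relation.Unary.Any as Any using (Any; here; there; any?; index)
import Data.List.Relation.Unary.Any.Properties as Any
open import Data.Product using (_×_; _,_; proj₁; proj₂; ∃-syntax)
open import Data.Sum as Sum using (_⊎_; inj₁; inj₂) renaming ([_,_]′ to [_,_])
open import Data.Vec using (Vec; []; _∷_; lookup; replicate; tabulate; zipWith)
import Data.Vec.Properties as Vec
open import Function using (_∘_; _on_)
open import Level using (0ℓ)
open import Relation.Nullary using (Dec; yes; no; ¬_; contradiction; ¬?; _→-dec_; _×-dec_)
open import Relation.Nullary.Decidable using (map′; toSum)
open import Relation.Binary.PropositionalEquality
  using (_≡_; refl; sym; trans; cong; cong₂; subst; subst₂; isMagma; module ≡-Reasoning)

-- Almost full relations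

-- An inductive form of "every infinite sequence has a pair i < j with `R xᵢ xⱼ`": after a first
-- point `a`, a later point `x` may also succeed by being related to `a`.
data AlmostFull {X : Set} (R : X → X → Set) : Set where
  now   : (∀ x y → R x y) → AlmostFull R
  later : (∀ a → AlmostFull (λ x y → R x y ⊎ R a x)) → AlmostFull R

module _ {X : Set} where

  private variable
    P Q R S : X → X → Set

  af-mono : (∀ {x y} → R x y → S x y) → AlmostFull R → AlmostFull S
  af-mono R⊆S (now r)   = now λ x y → R⊆S (r x y)
  af-mono R⊆S (later r) = later λ a → af-mono (Sum.map R⊆S R⊆S) (r a)

  -- Coquand's intuitionistic Ramsey theorem: intersections are handled first for
  -- constants, then for unary predicates, then for binary relations, each
  -- time relative to a disjunct R that absorbs the points already seen.
  af-∩₀ : {A B : Set} → AlmostFull P → AlmostFull Q →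
          (∀ {x y} → P x y → R x y ⊎ A) → (∀ {x y} → Q x y → R x y ⊎ B) →
          AlmostFull (λ x y → R x y ⊎ A × B)
  af-∩₀ (now p) q P⊆ Q⊆ =
    af-mono (λ {x} {y} Qxy → [ inj₁ , (λ a → Sum.map₂ (a ,_) (Q⊆ Qxy)) ] (P⊆ (p x y))) q
  af-∩₀ (later p) q P⊆ Q⊆ = later λ a →
    af-mono [ [ inj₁ ∘ inj₁ , inj₂ ∘ inj₁ ] , inj₁ ∘ inj₂ ]
      (af-∩₀ (p a) q
        [ Sum.map₁ inj₁ ∘ P⊆ , Sum.map₁ inj₂ ∘ P⊆ ]
        (Sum.map₁ inj₁ ∘ Q⊆))

  af-∩₁ : {A B : X → Set} → AlmostFull P → AlmostFull Q →
          (∀ {x y} → P x y → R x y ⊎ A x) → (∀ {x y} → Q x y → R x y ⊎ B x) →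
          AlmostFull (λ x y → R x y ⊎ A x × B x)
  af-∩₁ (now p) q P⊆ Q⊆ =
    af-mono (λ {x} {y} Qxy → [ inj₁ , (λ a → Sum.map₂ (a ,_) (Q⊆ Qxy)) ] (P⊆ (p x y))) q
  af-∩₁ p@(later _) (now q) P⊆ Q⊆ =
    af-mono (λ {x} {y} Pxy → [ inj₁ , (λ b → Sum.map₂ (_, b) (P⊆ Pxy)) ] (Q⊆ (q x y))) p
  af-∩₁ {R = R} {A = A} {B} p′@(later p) q′@(later q) P⊆ Q⊆ = later λ a →
    af-mono
      [ [ [ inj₁ ∘ inj₁ , inj₂ ∘ inj₁ ] , inj₁ ∘ inj₂ ] , inj₂ ∘ inj₂ ]
      -- Each recursive call advances only one of the two proofs at `a`, leaving the residue `A a`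
      -- or `B a`. These residues no longer depend on the points to come, so the constant case
      -- intersects them. For binary relations the residues are unary predicates, one level down in
      -- the same way.
      (af-∩₀ {R = λ x y → (R x y ⊎ R a x) ⊎ (A x × B x)}
        (af-∩₁ {R = λ x y → (R x y ⊎ R a x) ⊎ A a} (p a) q′
          [ Sum.map₁ (inj₁ ∘ inj₁) ∘ P⊆ , inj₁ ∘ Sum.map₁ inj₂ ∘ P⊆ ]
          (Sum.map₁ (inj₁ ∘ inj₁) ∘ Q⊆))
        (af-∩₁ {R = λ x y → (R x y ⊎ R a x) ⊎ B a} p′ (q a)
          (Sum.map₁ (inj₁ ∘ inj₁) ∘ P⊆)
          [ Sum.map₁ (inj₁ ∘ inj₁) ∘ Q⊆ , inj₁ ∘ Sum.map₁ inj₂ ∘ Q⊆ ])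
        [ Sum.map₁ inj₁ , inj₁ ∘ inj₂ ]
        [ Sum.map₁ inj₁ , inj₁ ∘ inj₂ ])

  af-∩₂ : {A B : X → X → Set} → AlmostFull P → AlmostFull Q →
          (∀ {x y} → P x y → R x y ⊎ A x y) → (∀ {x y} → Q x y → R x y ⊎ B x y) →
          AlmostFull (λ x y → R x y ⊎ A x y × B x y)
  af-∩₂ (now p) q P⊆ Q⊆ =
    af-mono (λ {x} {y} Qxy → [ inj₁ , (λ a → Sum.map₂ (a ,_) (Q⊆ Qxy)) ] (P⊆ (p x y))) q
  af-∩₂ p@(later _) (now q) P⊆ Q⊆ =
    af-mono (λ {x} {y} Pxy → [ inj₁ , (λ b → Sum.map₂ (_, b) (P⊆ Pxy)) ] (Q⊆ (q x y))) p
  af-∩₂ {R = R} {A = A} {B} p′@(later p) q′@(later q) P⊆ Q⊆ = later λ a →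
    af-mono
      [ [ [ inj₁ ∘ inj₁ , inj₂ ∘ inj₁ ] , inj₁ ∘ inj₂ ] , inj₂ ∘ inj₂ ]
      (af-∩₁ {R = λ x y → (R x y ⊎ R a x) ⊎ (A x y × B x y)}
        (af-∩₂ {R = λ x y → (R x y ⊎ R a x) ⊎ A a x} (p a) q′
          [ Sum.map₁ (inj₁ ∘ inj₁) ∘ P⊆ , inj₁ ∘ Sum.map₁ inj₂ ∘ P⊆ ]
          (Sum.map₁ (inj₁ ∘ inj₁) ∘ Q⊆))
        (af-∩₂ {R = λ x y → (R x y ⊎ R a x) ⊎ B a x} p′ (q a)
          (Sum.map₁ (inj₁ ∘ inj₁) ∘ P⊆)
          [ Sum.map₁ (inj₁ ∘ inj₁) ∘ Q⊆ , inj₁ ∘ Sum.map₁ inj₂ ∘ Q⊆ ])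
        [ Sum.map₁ inj₁ , inj₁ ∘ inj₂ ]
        [ Sum.map₁ inj₁ , inj₁ ∘ inj₂ ])

  af-∩ : AlmostFull P → AlmostFull Q → AlmostFull (λ x y → P x y × Q x y)
  af-∩ {P = P} {Q} p q =
    af-mono [ (λ PQ → PQ) , (λ PQ → PQ) ]
      (af-∩₂ {R = λ x y → P x y × Q x y} p q inj₂ inj₂)

af-comap : {X Y : Set} {R : Y → Y → Set} (f : X → Y) → AlmostFull R → AlmostFull (R on f)
af-comap f (now r)   = now λ x y → r (f x) (f y)
af-comap f (later r) = later λ a → af-comap f (r (f a))

-- This is `_≤_` after a first point `a`. Induction on the bound: a next point `b` above `a` settles
-- the matter, and for `b ≤ a` the disjunct `a ≤ x` of the smaller instance already gives `b ≤ x`.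
≤-or-above-af : ∀ a → AlmostFull (λ x y → x ≤ y ⊎ a ≤ x)
≤-or-above-af zero    = now λ _ _ → inj₂ z≤n
≤-or-above-af (suc a) = later step where
  step : ∀ b → AlmostFull (λ x y → (x ≤ y ⊎ suc a ≤ x) ⊎ (b ≤ x ⊎ suc a ≤ b))
  step b with b ≤? a
  ... | no  b≰a = now λ _ _ → inj₂ (inj₂ (≰⇒> b≰a))
  ... | yes b≤a = af-mono [ inj₁ ∘ inj₁ , inj₂ ∘ inj₁ ∘ ≤-trans b≤a ] (≤-or-above-af a)

≤-af : AlmostFull _≤_
≤-af = later ≤-or-above-af

-- Stated for coordinate functions on any `X`, so that it serves both markings and the indices of a
-- run.
dickson-af : ∀ {X : Set} {k} (f : Fin k → X → ℕ) → AlmostFull (λ x y → ∀ i → f i x ≤ f i y)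
dickson-af {k = zero}  f = now λ _ _ ()
dickson-af {k = suc k} f =
  af-mono (λ { (h , t) zero → h ; (h , t) (suc i) → t i })
    (af-∩ (af-comap (f zero) ≤-af) (dickson-af (f ∘ suc)))

-- Histories are listed with the most recent element first.
data Good {X : Set} (R : X → X → Set) : List X → Set where
  hit  : ∀ {y xs} → Any (λ x → R x y) xs → Good R (y ∷ xs)
  skip : ∀ {y xs} → Good R xs → Good R (y ∷ xs)

-- A history is barred if every way of extending it becomes good; recursion on this tree terminates
-- the Karp-Miller exploration.
data Barred {X : Set} (R : X → X → Set) (xs : List X) : Set where
  good : Good R xs → Barred R xs
  grow : (∀ x → Barred R (x ∷ xs)) → Barred R xs

module _ {X : Set} {R : X → X → Set} where

  -- The disjuncts collected by `later` are absorbed by the history: `S a x` gives a pair of `a`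
  -- with the coming `x`, or a pair that ends in `a`, or an older good pair.
  af⇒barred-from : ∀ {S xs} → AlmostFull S →
    (∀ {x y} → S x y → R x y ⊎ Any (λ z → R z x) xs ⊎ Good R xs) → Barred R xs
  af⇒barred-from (now s) S⊆ = grow λ x → grow λ y →
    good ([ hit ∘ here , [ skip ∘ hit , skip ∘ skip ] ] (S⊆ (s x y)))
  af⇒barred-from (later s) S⊆ = grow λ a → af⇒barred-from (s a)
    [ Sum.map₂ (Sum.map there skip) ∘ S⊆
    , inj₂ ∘ [ inj₁ ∘ here , inj₂ ∘ [ hit , skip ] ] ∘ S⊆ ]

  af⇒barred : AlmostFull R → Barred R []
  af⇒barred af = af⇒barred-from af inj₁

  prefix : (ℕ → X) → ℕ → List X
  prefix f zero    = []
  prefix f (suc k) = f k ∷ prefix f k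

  any-prefix : ∀ {P : X → Set} f k → Any P (prefix f k) → ∃[ i ] suc i ≤ k × P (f i)
  any-prefix f (suc k) (here p) = k , ≤-refl , p
  any-prefix f (suc k) (there p) with any-prefix f k p
  ... | i , i<k , q = i , m≤n⇒m≤1+n i<k , q

  good-prefix : ∀ f k → Good R (prefix f k) → ∃[ i ] ∃[ j ] suc i ≤ j × R (f i) (f j)
  good-prefix f (suc k) (hit p) with any-prefix f k p
  ... | i , i<k , r = i , k , i<k , r
  good-prefix f (suc k) (skip g) = good-prefix f k g

  barred-sequence : ∀ f k → Barred R (prefix f k) → ∃[ i ] ∃[ j ] suc i ≤ j × R (f i) (f j)
  barred-sequence f k (good g) = good-prefix f k g
  barred-sequence f k (grow b) = barred-sequence f (suc k) (b (f k))

  af-sequence : AlmostFull R → (f : ℕ → X) → ∃[ i ] ∃[ j ] suc i ≤ j × R (f i) (f j)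
  af-sequence af f = barred-sequence f 0 (af⇒barred af)

-- Semilinear sets and Kleene's algorithm

infixr 6 _∙_

_∙_ : ∀ {n} → Vec ℤ n → Vec ℤ n → Vec ℤ n
_∙_ = zipWith _+ℤ_

ε : ∀ {n} → Vec ℤ n
ε = replicate _ 0ℤ

vec-commutativeMonoid : ℕ → CommutativeMonoid 0ℓ 0ℓ
vec-commutativeMonoid n = record
  { Carrier = Vec ℤ n ; _≈_ = _≡_ ; _∙_ = _∙_ ; ε = ε
  ; isCommutativeMonoid = record
    { isMonoid = record
      { isSemigroup = record
        { isMagma = isMagma _∙_ ; assoc = Vec.zipWith-assoc ℤ.+-assoc }
      ; identity = Vec.zipWith-identityˡ ℤ.+-identityˡ , Vec.zipWith-identityʳ ℤ.+-identityʳ }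
    ; comm = Vec.zipWith-comm ℤ.+-comm } }

module _ {n : ℕ} where

  private
    V : Set
    V = Vec ℤ n

  open CommutativeMonoid (vec-commutativeMonoid n) using (identityˡ; identityʳ; assoc)
  open Algebra.Solver.CommutativeMonoid (vec-commutativeMonoid n) using (solve; _⊜_; _⊕_; id)

  data Span (P : List V) : V → Set where
    none : Span P ε
    add  : ∀ {p v} → p ∈ˡ P → Span P v → Span P (p ∙ v)

  span-generator : ∀ {P p} → p ∈ˡ P → Span P p
  span-generator p∈P = subst (Span _) (identityʳ _) (add p∈P none)

  span-∙ : ∀ {P v w} → Span P v → Span P w → Span P (v ∙ w)
  span-∙ none        t = subst (Span _) (sym (identityˡ _)) t
  span-∙ (add p∈P s) t = subst (Span _) (sym (assoc _ _ _)) (add p∈P (span-∙ s t))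

  span-⊆ : ∀ {P Q v} → P ⊆ Q → Span P v → Span Q v
  span-⊆ P⊆Q none        = none
  span-⊆ P⊆Q (add p∈P s) = add (P⊆Q p∈P) (span-⊆ P⊆Q s)

  span-++ : ∀ {P Q v w} → Span P v → Span Q w → Span (P ++ Q) (v ∙ w)
  span-++ {P} s t = span-∙ (span-⊆ ∈-++⁺ˡ s) (span-⊆ (∈-++⁺ʳ P) t)

  span-++⁻ : ∀ P {Q v} → Span (P ++ Q) v → ∃[ x ] ∃[ y ] Span P x × Span Q y × v ≡ x ∙ y
  span-++⁻ P none = _ , _ , none , none , sym (identityˡ _)
  span-++⁻ P (add {p} p∈ s) with ∈-++⁻ P p∈ | span-++⁻ P s
  ... | inj₁ p∈P | x , y , sx , sy , refl = p ∙ x , y , add p∈P sx , sy , sym (assoc p x y)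
  ... | inj₂ p∈Q | x , y , sx , sy , refl = x , p ∙ y , sx , add p∈Q sy ,
    solve 3 (λ p x y → p ⊕ x ⊕ y ⊜ x ⊕ p ⊕ y) refl p x y

  span-[]⁻ : ∀ {v} → Span [] v → v ≡ ε
  span-[]⁻ none = refl

  -- (b , P) stands for the linear set b + span P, and a list of such pairs for
  -- their union, a semilinear set.
  Linear Semilinear : Set
  Linear     = V × List V
  Semilinear = List Linear

  infix 4 _∈ˡⁱⁿ_ _∈ˢ_

  _∈ˡⁱⁿ_ : V → Linear → Set
  v ∈ˡⁱⁿ (b , P) = ∃[ s ] Span P s × v ≡ b ∙ s

  _∈ˢ_ : V → Semilinear → Set
  v ∈ˢ S = ∃[ ℓ ] ℓ ∈ˡ S × v ∈ˡⁱⁿ ℓ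

  singletons : List V → Semilinear
  singletons = map (_, [])

  singletons⁺ : ∀ {v vs} → v ∈ˡ vs → v ∈ˢ singletons vs
  singletons⁺ v∈vs = _ , ∈-map⁺ _ v∈vs , _ , none , sym (identityʳ _)

  singletons⁻ : ∀ {v} vs → v ∈ˢ singletons vs → v ∈ˡ vs
  singletons⁻ vs (ℓ , ℓ∈ , s , sp , refl) with ∈-map⁻ (_, []) ℓ∈
  ... | w , w∈vs , refl rewrite span-[]⁻ sp = subst (_∈ˡ vs) (sym (identityʳ w)) w∈vs

  infixr 6 _⊞_

  _⊞_ : Semilinear → Semilinear → Semilinear
  _⊞_ = cartesianProductWith λ (b , P) (c , Q) → b ∙ c , P ++ Q

  ⊞⁺ : ∀ {S T v w} → v ∈ˢ S → w ∈ˢ T → v ∙ w ∈ˢ S ⊞ T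
  ⊞⁺ ((b , P) , bP∈S , s , sp , refl) ((c , Q) , cQ∈T , t , tq , refl) =
    _ , ∈-cartesianProductWith⁺ _ bP∈S cQ∈T , s ∙ t , span-++ sp tq ,
    solve 4 (λ b s c t → (b ⊕ s) ⊕ (c ⊕ t) ⊜ (b ⊕ c) ⊕ (s ⊕ t)) refl b s c t

  ⊞⁻ : ∀ S T {v} → v ∈ˢ S ⊞ T → ∃[ x ] ∃[ y ] x ∈ˢ S × y ∈ˢ T × v ≡ x ∙ y
  ⊞⁻ S T (ℓ , ℓ∈ , u , sp , refl) with ∈-cartesianProductWith⁻ _ S T ℓ∈
  ... | (b , P) , (c , Q) , bP∈S , cQ∈T , refl with span-++⁻ P sp
  ... | s , t , sP , tQ , refl =
    b ∙ s , c ∙ t , (_ , bP∈S , s , sP , refl) , (_ , cQ∈T , t , tQ , refl) ,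
    solve 4 (λ b s c t → (b ⊕ c) ⊕ (s ⊕ t) ⊜ (b ⊕ s) ⊕ (c ⊕ t)) refl b s c t

  data Star (X : V → Set) : V → Set where
    []  : Star X ε
    _∷_ : ∀ {v w} → X v → Star X w → Star X (v ∙ w)

  star-map : ∀ {X Y : V → Set} → (∀ {v} → X v → Y v) → ∀ {v} → Star X v → Star Y v
  star-map f []       = []
  star-map f (x ∷ xs) = f x ∷ star-map f xs

  -- A sum of elements of S ∪ (b + span P) that uses the second set at all
  -- is b plus an element of span (b ∷ P), plus a sum of elements of S.
  star : Semilinear → Semilinear
  star []            = (ε , []) ∷ []
  star ((b , P) ∷ S) = star S ++ map (λ (c , Q) → b ∙ c , (b ∷ P) ++ Q) (star S)

  star-split : ∀ {b P S v} → Star (_∈ˢ (b , P) ∷ S) v →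
    Star (_∈ˢ S) v ⊎ ∃[ s ] ∃[ w ] Span (b ∷ P) s × Star (_∈ˢ S) w × v ≡ (b ∙ s) ∙ w
  star-split [] = inj₁ []
  star-split {b} ((_ , here refl , s , sp , refl) ∷ xs) with star-split xs
  ... | inj₁ ws = inj₂ (s , _ , span-⊆ there sp , ws , refl)
  ... | inj₂ (s′ , w , sp′ , ws , refl) =
    inj₂ (s ∙ b ∙ s′ , w , span-∙ (span-⊆ there sp) (add (here refl) sp′) , ws ,
      solve 4 (λ b s s′ w → (b ⊕ s) ⊕ (b ⊕ s′) ⊕ w ⊜ (b ⊕ s ⊕ b ⊕ s′) ⊕ w) refl b s s′ w)
  star-split {b} (_∷_ {x} (ℓ , there ℓ∈S , x∈ℓ) xs) with star-split xs
  ... | inj₁ ws = inj₁ ((ℓ , ℓ∈S , x∈ℓ) ∷ ws)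
  ... | inj₂ (s , w , sp , ws , refl) =
    inj₂ (s , x ∙ w , sp , (ℓ , ℓ∈S , x∈ℓ) ∷ ws ,
      solve 4 (λ b x s w → x ⊕ (b ⊕ s) ⊕ w ⊜ (b ⊕ s) ⊕ x ⊕ w) refl b x s w)

  star-complete : ∀ S {v} → Star (_∈ˢ S) v → v ∈ˢ star S
  star-complete [] [] = _ , here refl , ε , none , sym (identityˡ ε)
  star-complete ((b , P) ∷ S) xs with star-split xs
  ... | inj₁ ws with star-complete S ws
  ...   | ℓ , ℓ∈ , v∈ℓ = ℓ , ∈-++⁺ˡ ℓ∈ , v∈ℓ
  star-complete ((b , P) ∷ S) xs | inj₂ (s , w , sp , ws , refl) with star-complete S ws
  ...   | (c , Q) , cQ∈ , t , tQ , refl =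
    _ , ∈-++⁺ʳ (star S) (∈-map⁺ _ cQ∈) , s ∙ t , span-++ sp tQ ,
    solve 4 (λ b s c t → (b ⊕ s) ⊕ (c ⊕ t) ⊜ (b ⊕ c) ⊕ (s ⊕ t)) refl b s c t

  -- A first copy of `b` takes all generators from `P`; every further `b` is a summand of its own,
  -- with empty span part.
  star-unroll : ∀ {b P S s} → (b , P) ∈ˡ S → Span (b ∷ P) s →
    ∃[ t ] ∃[ w ] Span P t × Star (_∈ˢ S) w × b ∙ s ≡ (b ∙ t) ∙ w
  star-unroll bP∈S none = ε , ε , none , [] , sym (identityʳ _)
  star-unroll {b} bP∈S (add (here refl) sp) with star-unroll bP∈S sp
  ... | t , w , tP , ws , eq =
    t , b ∙ w , tP ,
    subst (λ x → Star _ (x ∙ w)) (identityʳ b) ((_ , bP∈S , ε , none , refl) ∷ ws) ,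
    trans (cong (b ∙_) eq)
      (solve 3 (λ b t w → b ⊕ (b ⊕ t) ⊕ w ⊜ (b ⊕ t) ⊕ b ⊕ w) refl b t w)
  star-unroll {b} bP∈S (add {p} {s} (there p∈P) sp) with star-unroll bP∈S sp
  ... | t , w , tP , ws , eq =
    p ∙ t , w , add p∈P tP , ws ,
    trans (solve 3 (λ b p s → b ⊕ p ⊕ s ⊜ p ⊕ b ⊕ s) refl b p s)
      (trans (cong (p ∙_) eq)
        (solve 4 (λ b p t w → p ⊕ (b ⊕ t) ⊕ w ⊜ (b ⊕ p ⊕ t) ⊕ w) refl b p t w))

  star-sound : ∀ S {v} → v ∈ˢ star S → Star (_∈ˢ S) v
  star-sound [] (_ , here refl , s , sp , refl) rewrite span-[]⁻ sp =
    subst (Star _) (sym (identityˡ ε)) []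
  star-sound ((b , P) ∷ S) (ℓ , ℓ∈ , v∈ℓ) with ∈-++⁻ (star S) ℓ∈
  ... | inj₁ ℓ∈S* =
    star-map (λ (ℓ , ℓ∈S , v∈ℓ) → ℓ , there ℓ∈S , v∈ℓ) (star-sound S (ℓ , ℓ∈S* , v∈ℓ))
  ... | inj₂ ℓ∈map with ∈-map⁻ _ ℓ∈map | v∈ℓ
  ...   | (c , Q) , cQ∈ , refl | _ , sp , refl with span-++⁻ (b ∷ P) sp
  ...     | s , t , sbP , tQ , refl with star-unroll {S = (b , P) ∷ S} (here refl) sbP
  ...       | s′ , w , s′P , ws , eq =
    subst (Star _)
      (trans (cong (_∙ (c ∙ t)) (sym eq))
        (solve 4 (λ b s c t → (b ⊕ s) ⊕ (c ⊕ t) ⊜ (b ⊕ c) ⊕ (s ⊕ t)) refl b s c t))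
      (star-∙ ((_ , here refl , s′ , s′P , refl) ∷ ws)
        (star-map (λ (ℓ , ℓ∈S , v∈ℓ) → ℓ , there ℓ∈S , v∈ℓ)
          (star-sound S (_ , cQ∈ , t , tQ , refl))))
    where
    star-∙ : ∀ {X : V → Set} {v w} → Star X v → Star X w → Star X (v ∙ w)
    star-∙ []       ys = subst (Star _) (sym (identityˡ _)) ys
    star-∙ (x ∷ xs) ys = subst (Star _) (sym (assoc _ _ _)) (x ∷ star-∙ xs ys)

  module Kleene {A : Set} (E : A → A → List V) where

    -- Only intermediate nodes are restricted to `xs`. Walks have at least one edge, since an empty
    -- closed walk would be trivially nonnegative.
    data Walk (xs : List A) (i j : A) : V → Set where
      edge : ∀ {v} → v ∈ˡ E i j → Walk xs i j v
      step : ∀ {k v w} → v ∈ˡ E i k → k ∈ˡ xs → Walk xs k j w → Walk xs i j (v ∙ w)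

    walk-∙ : ∀ {xs i k j v w} → Walk xs i k v → k ∈ˡ xs → Walk xs k j w → Walk xs i j (v ∙ w)
    walk-∙ (edge e)       k∈ t = step e k∈ t
    walk-∙ (step e l∈ s) k∈ t = subst (Walk _ _ _) (sym (assoc _ _ _)) (step e l∈ (walk-∙ s k∈ t))

    walk-⊆ : ∀ {xs ys i j v} → xs ⊆ ys → Walk xs i j v → Walk ys i j v
    walk-⊆ xs⊆ys (edge e)      = edge e
    walk-⊆ xs⊆ys (step e k∈ s) = step e (xs⊆ys k∈) (walk-⊆ xs⊆ys s)

    kleene : List A → A → A → Semilinear
    kleene []       i j = singletons (E i j)
    kleene (x ∷ xs) i j =
      kleene xs i j ++ (kleene xs i x ⊞ star (kleene xs x x) ⊞ kleene xs x j)

    -- Cuts the walk at its visits to `x`: up to the first, between consecutive ones, after the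
    -- last.
    walk-split : ∀ {x xs i j v} → Walk (x ∷ xs) i j v →
      Walk xs i j v ⊎ ∃[ a ] ∃[ b ] ∃[ c ]
        Walk xs i x a × Star (Walk xs x x) b × Walk xs x j c × v ≡ a ∙ b ∙ c
    walk-split (edge e) = inj₁ (edge e)
    walk-split (step {v = v} e (here refl) s) with walk-split s
    ... | inj₁ c = inj₂ (v , ε , _ , edge e , [] , c , cong (v ∙_) (sym (identityˡ _)))
    ... | inj₂ (a , b , c , wa , wb , wc , refl) =
      inj₂ (v , a ∙ b , c , edge e , wa ∷ wb , wc , cong (v ∙_) (sym (assoc a b c)))
    walk-split (step {v = v} e (there k∈) s) with walk-split s
    ... | inj₁ s′ = inj₁ (step e k∈ s′)
    ... | inj₂ (a , b , c , wa , wb , wc , refl) =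
      inj₂ (v ∙ a , b , c , step e k∈ wa , wb , wc , sym (assoc v a (b ∙ c)))

    kleene-complete : ∀ xs {i j v} → Walk xs i j v → v ∈ˢ kleene xs i j
    kleene-complete []       (edge e) = singletons⁺ e
    kleene-complete (x ∷ xs) {i} {j} w with walk-split w
    ... | inj₁ w′ with kleene-complete xs w′
    ...   | ℓ , ℓ∈ , v∈ℓ = ℓ , ∈-++⁺ˡ ℓ∈ , v∈ℓ
    kleene-complete (x ∷ xs) {i} {j} w | inj₂ (a , b , c , wa , wb , wc , refl)
      with ⊞⁺ (kleene-complete xs wa)
             (⊞⁺ (star-complete _ (star-map (kleene-complete xs) wb)) (kleene-complete xs wc))
    ...   | ℓ , ℓ∈ , v∈ℓ = ℓ , ∈-++⁺ʳ (kleene xs i j) ℓ∈ , v∈ℓ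

    kleene-sound : ∀ xs {i j v} → v ∈ˢ kleene xs i j → Walk xs i j v
    kleene-sound [] {i} {j} v∈ = edge (singletons⁻ (E i j) v∈)
    kleene-sound (x ∷ xs) {i} {j} (ℓ , ℓ∈ , v∈ℓ) with ∈-++⁻ (kleene xs i j) ℓ∈
    ... | inj₁ ℓ∈ˡ = walk-⊆ there (kleene-sound xs (ℓ , ℓ∈ˡ , v∈ℓ))
    ... | inj₂ ℓ∈ʳ
      with a , _ , a∈ , bc∈ , refl ← ⊞⁻ (kleene xs i x) _ (ℓ , ℓ∈ʳ , v∈ℓ)
      with b , c , b∈ , c∈ , refl ← ⊞⁻ (star (kleene xs x x)) (kleene xs x j) bc∈ =
      walk-∙ (walk-⊆ there (kleene-sound xs a∈)) (here refl)
        (loops (star-map (kleene-sound xs) (star-sound _ b∈)) (walk-⊆ there (kleene-sound xs c∈)))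
      where
      loops : ∀ {b c} → Star (Walk xs x x) b → Walk (x ∷ xs) x j c → Walk (x ∷ xs) x j (b ∙ c)
      loops []       t = subst (Walk _ _ _) (sym (identityˡ _)) t
      loops (s ∷ ss) t =
        subst (Walk _ _ _) (sym (assoc _ _ _)) (walk-∙ (walk-⊆ there s) (here refl) (loops ss t))

-- Fourier-Motzkin elimination

lookup-∙ : ∀ {n} (v w : Vec ℤ n) q → lookup (v ∙ w) q ≡ lookup v q +ℤ lookup w q
lookup-∙ v w q = Vec.lookup-zipWith _+ℤ_ q v w

∣i+j∣-nonneg : ∀ {i j} → 0ℤ ≤ℤ i → 0ℤ ≤ℤ j → ∣ i +ℤ j ∣ℤ ≡ ∣ i ∣ℤ + ∣ j ∣ℤ
∣i+j∣-nonneg (+≤+ _) (+≤+ _) = refl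

∣i+j∣-nonpos : ∀ {i j} → i ≤ℤ 0ℤ → j ≤ℤ 0ℤ → ∣ i +ℤ j ∣ℤ ≡ ∣ i ∣ℤ + ∣ j ∣ℤ
∣i+j∣-nonpos (+≤+ z≤n) (+≤+ z≤n)  = refl
∣i+j∣-nonpos (+≤+ z≤n) -≤+          = refl
∣i+j∣-nonpos -≤+         (+≤+ z≤n)  = sym (+-identityʳ _)
∣i+j∣-nonpos { -[1+ m ]} { -[1+ n ]} -≤+ -≤+ = cong suc (sym (+-suc m n))

-- The form `suc k` records that `i` is positive, so that it can serve as a scaling factor in
-- `eliminate-complete`.
outweighs : ∀ {i j} → j <ℤ 0ℤ → 0ℤ ≤ℤ i +ℤ j → ∃[ k ] ∣ i ∣ℤ ≡ suc k × ∣ j ∣ℤ ≤ suc k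
outweighs {i} { -[1+ j ]} _ 0≤i+j with ℤ.0≤i-j⇒j≤i {i} {+ suc j} 0≤i+j
outweighs {+ suc i} { -[1+ j ]} _ _ | +≤+ j≤i = i , refl , j≤i
outweighs {+ zero} { -[1+ j ]} _ _ | +≤+ ()
outweighs {i} {+ _} (+<+ ())

module _ {n : ℕ} where

  private
    V : Set
    V = Vec ℤ n

  open CommutativeMonoid (vec-commutativeMonoid n) using (identityˡ; identityʳ; comm)
  open Mult (vec-commutativeMonoid n) using (×-homo-+; ×-distrib-+) renaming (_×_ to _·_)
  open Algebra.Solver.CommutativeMonoid (vec-commutativeMonoid n) using (solve; _⊜_; _⊕_)

  lookup-ε : ∀ q → lookup (ε {n}) q ≡ 0ℤ
  lookup-ε q = Vec.lookup-replicate q 0ℤ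

  lookup-· : ∀ k (v : V) q → lookup (k · v) q ≡ + k *ℤ lookup v q
  lookup-· zero    v q = trans (lookup-ε q) (sym (ℤ.*-zeroˡ (lookup v q)))
  lookup-· (suc k) v q = begin
    lookup (v ∙ k · v) q               ≡⟨ lookup-∙ v (k · v) q ⟩
    lookup v q +ℤ lookup (k · v) q     ≡⟨ cong (lookup v q +ℤ_) (lookup-· k v q) ⟩
    lookup v q +ℤ + k *ℤ lookup v q    ≡⟨ ℤ.suc-* (+ k) (lookup v q) ⟨
    + suc k *ℤ lookup v q              ∎
    where open ≡-Reasoning

  ·-ε : ∀ k → k · ε ≡ ε {n}
  ·-ε zero    = refl
  ·-ε (suc k) = trans (identityˡ (k · ε)) (·-ε k)

  span-· : ∀ {P : List V} {v} k → Span P v → Span P (k · v)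
  span-· zero    s = none
  span-· (suc k) s = span-∙ s (span-· k s)

  span-bind : ∀ {P Q : List V} {v} → (∀ {p} → p ∈ˡ P → Span Q p) → Span P v → Span Q v
  span-bind f none        = none
  span-bind f (add p∈P s) = span-∙ (f p∈P) (span-bind f s)

  span-nonneg : ∀ q {P : List V} {v} → (∀ {p} → p ∈ˡ P → 0ℤ ≤ℤ lookup p q) → Span P v → 0ℤ ≤ℤ lookup v q
  span-nonneg q f none = ℤ.≤-reflexive (sym (lookup-ε q))
  span-nonneg q f (add {p} {v} p∈P s) =
    subst (0ℤ ≤ℤ_) (sym (lookup-∙ p v q)) (ℤ.+-mono-≤ (f p∈P) (span-nonneg q f s))

  span-nonpos : ∀ q {P : List V} {v} → (∀ {p} → p ∈ˡ P → lookup p q ≤ℤ 0ℤ) → Span P v → lookup v q ≤ℤ 0ℤ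
  span-nonpos q f none = ℤ.≤-reflexive (lookup-ε q)
  span-nonpos q f (add {p} {v} p∈P s) =
    subst (_≤ℤ 0ℤ) (sym (lookup-∙ p v q)) (ℤ.+-mono-≤ (f p∈P) (span-nonpos q f s))

  -- If v and w have opposite signs at q, their q-entries cancel here.
  balance : Fin n → V → V → V
  balance q v w = (∣ lookup w q ∣ℤ · v) ∙ (∣ lookup v q ∣ℤ · w)

  balance-comm : ∀ q v w → balance q v w ≡ balance q w v
  balance-comm q v w = comm _ _

  balance-εˡ : ∀ q w → balance q ε w ≡ ε
  balance-εˡ q w rewrite lookup-ε q = trans (identityʳ _) (·-ε ∣ lookup w q ∣ℤ)

  -- Absolute values add up only if nothing cancels at `q`, hence the hypothesis; it holds when both
  -- entries have the same sign.
  balance-∙ˡ : ∀ q u v w → ∣ lookup u q +ℤ lookup v q ∣ℤ ≡ ∣ lookup u q ∣ℤ + ∣ lookup v q ∣ℤ →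
    balance q (u ∙ v) w ≡ balance q u w ∙ balance q v w
  balance-∙ˡ q u v w eq = begin
    (k · (u ∙ v)) ∙ (∣ lookup (u ∙ v) q ∣ℤ · w)
      ≡⟨ cong₂ (λ x m → x ∙ (m · w)) (×-distrib-+ u v k) (trans (cong ∣_∣ℤ (lookup-∙ u v q)) eq) ⟩
    ((k · u) ∙ (k · v)) ∙ ((a + b) · w)
      ≡⟨ cong (((k · u) ∙ (k · v)) ∙_) (×-homo-+ w a b) ⟩
    ((k · u) ∙ (k · v)) ∙ ((a · w) ∙ (b · w))
      ≡⟨ solve 4 (λ x y z t → (x ⊕ y) ⊕ (z ⊕ t) ⊜ (x ⊕ z) ⊕ (y ⊕ t)) refl _ _ _ _ ⟩
    balance q u w ∙ balance q v w ∎
    where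
    open ≡-Reasoning
    k a b : ℕ
    k = ∣ lookup w q ∣ℤ
    a = ∣ lookup u q ∣ℤ
    b = ∣ lookup v q ∣ℤ

  nonnegative negative : Fin n → List V → List V
  nonnegative q = filter (λ d → 0ℤ ≤ℤ? lookup d q)
  negative    q = filter (λ d → lookup d q <ℤ? 0ℤ)

  -- One Fourier-Motzkin step: the combinations of D that are nonnegative at q
  -- are, up to a positive multiple, the combinations of eliminate q D.
  eliminate : Fin n → List V → List V
  eliminate q D = nonnegative q D ++ cartesianProductWith (balance q) (nonnegative q D) (negative q D)

  module _ (q : Fin n) (D : List V) where

    private
      D⁺ D⁻ : List V
      D⁺ = nonnegative q D
      D⁻ = negative q D

      D⁺-nonneg : ∀ {d} → d ∈ˡ D⁺ → 0ℤ ≤ℤ lookup d q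
      D⁺-nonneg = proj₂ ∘ ∈-filter⁻ _ {xs = D}

      D⁻-neg : ∀ {d} → d ∈ˡ D⁻ → lookup d q <ℤ 0ℤ
      D⁻-neg = proj₂ ∘ ∈-filter⁻ _ {xs = D}

    eliminate-sound : ∀ {d} → d ∈ˡ eliminate q D → Span D d
    eliminate-sound d∈ with ∈-++⁻ D⁺ d∈
    ... | inj₁ d∈⁺ = span-generator (proj₁ (∈-filter⁻ _ d∈⁺))
    ... | inj₂ d∈× with ∈-cartesianProductWith⁻ _ D⁺ D⁻ d∈×
    ...   | u , w , u∈ , w∈ , refl =
      span-∙ (span-· ∣ lookup w q ∣ℤ (span-generator (proj₁ (∈-filter⁻ _ u∈))))
             (span-· ∣ lookup u q ∣ℤ (span-generator (proj₁ (∈-filter⁻ _ w∈))))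

    balance-cancels : ∀ {u w} → 0ℤ ≤ℤ lookup u q → lookup w q <ℤ 0ℤ → lookup (balance q u w) q ≡ 0ℤ
    balance-cancels {u} {w} u≥0 w<0 =
      trans (lookup-∙ (∣ lookup w q ∣ℤ · u) (∣ lookup u q ∣ℤ · w) q)
        (trans (cong₂ _+ℤ_ (lookup-· ∣ lookup w q ∣ℤ u q) (lookup-· ∣ lookup u q ∣ℤ w q))
          (cancels u≥0 w<0))
      where
      cancels : ∀ {i j} → 0ℤ ≤ℤ i → j <ℤ 0ℤ → (+ ∣ j ∣ℤ *ℤ i) +ℤ (+ ∣ i ∣ℤ *ℤ j) ≡ 0ℤ
      cancels {+ i} { -[1+ j ]} _ _ =
        trans (cong (_+ℤ (+ i *ℤ -[1+ j ])) (ℤ.*-comm (+ suc j) (+ i)))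
          (trans (sym (ℤ.*-distribˡ-+ (+ i) (+ suc j) -[1+ j ]))
            (trans (cong (+ i *ℤ_) (ℤ.+-inverseʳ (+ suc j))) (ℤ.*-zeroʳ (+ i))))
      cancels {+ _} {+ _} _ (+<+ ())

    eliminate-nonneg : ∀ {d} → d ∈ˡ eliminate q D → 0ℤ ≤ℤ lookup d q
    eliminate-nonneg d∈ with ∈-++⁻ D⁺ d∈
    ... | inj₁ d∈⁺ = D⁺-nonneg d∈⁺
    ... | inj₂ d∈× with ∈-cartesianProductWith⁻ _ D⁺ D⁻ d∈×
    ...   | u , w , u∈ , w∈ , refl =
      ℤ.≤-reflexive (sym (balance-cancels {u} {w} (D⁺-nonneg u∈) (D⁻-neg w∈)))

    private
      balance-spanˡ : ∀ {v e} → Span D⁺ v → e ∈ˡ D⁻ → Span (eliminate q D) (balance q v e)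
      balance-spanˡ {e = e} none e∈ = subst (Span _) (sym (balance-εˡ q e)) none
      balance-spanˡ {e = e} (add {d} {v} d∈ s) e∈ =
        subst (Span _)
          (sym (balance-∙ˡ q d v e (∣i+j∣-nonneg (D⁺-nonneg d∈) (span-nonneg q D⁺-nonneg s))))
          (add (∈-++⁺ʳ D⁺ (∈-cartesianProductWith⁺ (balance q) d∈ e∈)) (balance-spanˡ s e∈))

      -- Within one sign class `balance` is additive in each argument, so it expands into balances
      -- of pairs of generators.
      balance-span : ∀ {v w} → Span D⁺ v → Span D⁻ w → Span (eliminate q D) (balance q w v)
      balance-span {v} s none = subst (Span _) (sym (balance-εˡ q v)) none
      balance-span {v} s (add {e} {w} e∈ t) =
        subst (Span _)
          (sym (balance-∙ˡ q e w v
            (∣i+j∣-nonpos (ℤ.<⇒≤ (D⁻-neg e∈)) (span-nonpos q (ℤ.<⇒≤ ∘ D⁻-neg) t))))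
          (span-∙ (subst (Span _) (balance-comm q v e) (balance-spanˡ s e∈)) (balance-span s t))

      D⊆ : D ⊆ D⁺ ++ D⁻
      D⊆ {d} d∈ with 0ℤ ≤ℤ? lookup d q
      ... | yes d≥0 = ∈-++⁺ˡ (∈-filter⁺ _ d∈ d≥0)
      ... | no  d≱0 = ∈-++⁺ʳ D⁺ (∈-filter⁺ _ d∈ (ℤ.≰⇒> d≱0))

    -- Write `x = v ∙ w` with `v` from the nonnegative and `w` from the negative generators, and let
    -- a and b be the absolute values of their entries at `q`. Then b ≤ a, and a times `x` is (a -
    -- b) times `v` plus `balance q w v`. Without negative generators the factor 1 works.
    eliminate-complete : ∀ {x} → Span D x → 0ℤ ≤ℤ lookup x q →
      ∃[ k ] Span (eliminate q D) (suc k · x)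
    eliminate-complete x∈ x≥0 with span-++⁻ D⁺ (span-⊆ D⊆ x∈)
    ... | v , _ , s , none , refl =
      0 , subst (Span _) (sym (trans (identityʳ _) (identityʳ v))) (span-⊆ ∈-++⁺ˡ s)
    ... | v , w , s , t@(add {e} {w′} e∈ t′) , refl
      with outweighs {lookup v q} {lookup w q}
             (subst (_<ℤ 0ℤ) (sym (lookup-∙ e w′ q))
               (ℤ.+-mono-<-≤ (D⁻-neg e∈) (span-nonpos q (ℤ.<⇒≤ ∘ D⁻-neg) t′)))
             (subst (0ℤ ≤ℤ_) (lookup-∙ v w q) x≥0)
    ...   | k , eq , b≤a =
      k , subst (Span _) calculation
            (span-∙ (span-· (suc k ∸ b) (span-⊆ ∈-++⁺ˡ s)) (balance-span s t))
      where
      open ≡-Reasoning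
      b : ℕ
      b = ∣ lookup w q ∣ℤ
      calculation : ((suc k ∸ b) · v) ∙ balance q w v ≡ suc k · (v ∙ w)
      calculation = begin
        ((suc k ∸ b) · v) ∙ ((∣ lookup v q ∣ℤ · w) ∙ (b · v))
          ≡⟨ cong (λ a → ((suc k ∸ b) · v) ∙ ((a · w) ∙ (b · v))) eq ⟩
        ((suc k ∸ b) · v) ∙ ((suc k · w) ∙ (b · v))
          ≡⟨ solve 3 (λ x y z → x ⊕ (y ⊕ z) ⊜ (x ⊕ z) ⊕ y) refl _ (suc k · w) _ ⟩
        (((suc k ∸ b) · v) ∙ (b · v)) ∙ (suc k · w)
          ≡⟨ cong (_∙ (suc k · w)) (×-homo-+ v (suc k ∸ b) b) ⟨
        ((suc k ∸ b + b) · v) ∙ (suc k · w)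
          ≡⟨ cong (λ a → (a · v) ∙ (suc k · w)) (m∸n+n≡m b≤a) ⟩
        (suc k · v) ∙ (suc k · w)
          ≡⟨ ×-distrib-+ v w (suc k) ⟨
        suc k · (v ∙ w) ∎

  eliminateAll : List (Fin n) → List V → List V
  eliminateAll []       D = D
  eliminateAll (q ∷ qs) D = eliminateAll qs (eliminate q D)

  eliminateAll-sound : ∀ qs {D d} → d ∈ˡ eliminateAll qs D → Span D d
  eliminateAll-sound []       d∈ = span-generator d∈
  eliminateAll-sound (q ∷ qs) {D} d∈ = span-bind (eliminate-sound q D) (eliminateAll-sound qs d∈)

  -- Later steps only form natural combinations of vectors that are already nonnegative at `q`, so
  -- they preserve this.
  eliminateAll-nonneg : ∀ qs {D d q} → q ∈ˡ qs → d ∈ˡ eliminateAll qs D → 0ℤ ≤ℤ lookup d q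
  eliminateAll-nonneg (q ∷ qs) {D} (here refl) d∈ =
    span-nonneg q (eliminate-nonneg q D) (eliminateAll-sound qs d∈)
  eliminateAll-nonneg (q ∷ qs) (there q∈) d∈ = eliminateAll-nonneg qs q∈ d∈

  nonneg-multiple : ∀ k {x : V} {q} → 0ℤ ≤ℤ lookup x q → 0ℤ ≤ℤ lookup (k · x) q
  nonneg-multiple k {x} {q} x≥0 =
    subst (_≤ℤ lookup (k · x) q) (ℤ.*-zeroʳ (+ k))
      (subst (+ k *ℤ 0ℤ ≤ℤ_) (sym (lookup-· k x q)) (ℤ.*-monoˡ-≤-nonNeg (+ k) x≥0))

  positive-multiple : ∀ k {x : V} {q} → 0ℤ <ℤ lookup x q → 0ℤ <ℤ lookup (suc k · x) q
  positive-multiple k {x} {q} x>0 =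
    subst (_<ℤ lookup (suc k · x) q) (ℤ.*-zeroʳ (+ suc k))
      (subst (+ suc k *ℤ 0ℤ <ℤ_) (sym (lookup-· (suc k) x q)) (ℤ.*-monoˡ-<-pos (+ suc k) x>0))

  eliminateAll-complete : ∀ qs {D x q} → Span D x → (∀ q → 0ℤ ≤ℤ lookup x q) → 0ℤ <ℤ lookup x q →
    ∃[ y ] Span (eliminateAll qs D) y × 0ℤ <ℤ lookup y q
  eliminateAll-complete []       s x≥0 x>0 = _ , s , x>0
  eliminateAll-complete (q ∷ qs) {x = x} s x≥0 x>0 with eliminate-complete q _ s (x≥0 q)
  ... | k , s′ = eliminateAll-complete qs s′ (λ q → nonneg-multiple (suc k) {x} (x≥0 q))
      (positive-multiple k {x} x>0)

  span-positive : ∀ q {P : List V} {v} → Span P v → 0ℤ <ℤ lookup v q → Any (λ p → 0ℤ <ℤ lookup p q) P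
  span-positive q {P} s v>0 with any? (λ p → 0ℤ <ℤ? lookup p q) P
  ... | yes p = p
  ... | no ¬p =
    contradiction (ℤ.<-≤-trans v>0 (span-nonpos q (λ p∈ → ℤ.≮⇒≥ (¬p ∘ lose p∈)) s)) (ℤ.<-irrefl refl)

  -- After all coordinates are eliminated, the remaining generators are nonnegative themselves and
  -- span some positive multiple of every solution; hence a solution exists iff one of them is
  -- positive at `h`.
  span-nonneg? : ∀ (P : List V) h →
    Dec (∃[ v ] Span P v × (∀ q → 0ℤ ≤ℤ lookup v q) × 0ℤ <ℤ lookup v h)
  span-nonneg? P h with any? (λ p → 0ℤ <ℤ? lookup p h) (eliminateAll (allFin n) P)
  ... | yes a with find a
  ...   | d , d∈ , d>0 =
    yes (d , eliminateAll-sound (allFin n) d∈ , (λ q → eliminateAll-nonneg (allFin n) (∈-allFin q) d∈) , d>0)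
  span-nonneg? P h | no ¬a = no λ (v , s , v≥0 , v>0) →
    let y , sy , y>0 = eliminateAll-complete (allFin n) s v≥0 v>0 in ¬a (span-positive h sy y>0)

-- Deciding the existence of nonnegative closed walks

module _ {n : ℕ} where

  private
    V : Set
    V = Vec ℤ n

  open CommutativeMonoid (vec-commutativeMonoid n) using (identityˡ; assoc)
  open Mult (vec-commutativeMonoid n) using () renaming (_×_ to _·_)
  open Algebra.Solver.CommutativeMonoid (vec-commutativeMonoid n) using (solve; _⊜_; _⊕_)

  -- The extra head entry counts how often b is used.
  counting : V → List V → List (Vec ℤ (suc n))
  counting b P = (1ℤ ∷ b) ∷ map (0ℤ ∷_) P

  counting⁺ : ∀ {b P s} → Span P s → Span (counting b P) (0ℤ ∷ s)
  counting⁺ none        = none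
  counting⁺ (add p∈P s) = add (there (∈-map⁺ (0ℤ ∷_) p∈P)) (counting⁺ s)

  counting⁻ : ∀ {b P x} → Span (counting b P) x →
    ∃[ k ] ∃[ s ] Span P s × x ≡ + k ∷ (k · b) ∙ s
  counting⁻ none = 0 , ε , none , cong (0ℤ ∷_) (sym (identityˡ ε))
  counting⁻ {b} (add (here refl) sp) with counting⁻ sp
  ... | k , s , sP , refl = suc k , s , sP , cong (+ suc k ∷_) (sym (assoc b (k · b) s))
  counting⁻ {b} (add (there p∈) sp) with ∈-map⁻ (0ℤ ∷_) p∈ | counting⁻ sp
  ... | p , p∈P , refl | k , s , sP , refl =
    k , p ∙ s , add p∈P sP ,
    cong (+ k ∷_) (solve 3 (λ p x s → p ⊕ x ⊕ s ⊜ x ⊕ p ⊕ s) refl p (k · b) s)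

  module _ {A : Set} (E : A → A → List V) where
    open Kleene E

    walk-· : ∀ {xs i v w} k → i ∈ˡ xs → Walk xs i i v → Walk xs i i w → Walk xs i i ((k · v) ∙ w)
    walk-· zero    i∈ s t = subst (Walk _ _ _) (sym (identityˡ _)) t
    walk-· (suc k) i∈ s t = subst (Walk _ _ _) (sym (assoc _ _ _)) (walk-∙ s i∈ (walk-· k i∈ s t))

    nonneg-cycle? : ∀ xs {i} → i ∈ˡ xs → Dec (∃[ v ] Walk xs i i v × (∀ q → 0ℤ ≤ℤ lookup v q))
    nonneg-cycle? xs {i} i∈
      with any? (λ (b , P) → span-nonneg? (counting b P) zero) (kleene xs i i)
    ... | yes a with find a
    ...   | (b , P) , bP∈ , x , x∈ , x≥0 , x>0 with counting⁻ x∈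
    ...     | zero  , s , sP , refl with () ← ℤ.<-irrefl refl x>0
    ...     | suc k , s , sP , refl =
      -- The `suc k` copies of `b` and the vector `s` are realised by `k` closed walks of weight `b`
      -- followed by one of weight `b ∙ s`.
      yes (b ∙ (k · b) ∙ s , subst (Walk xs i i) eq
            (walk-· k i∈ (subst (Walk xs i i) (identityʳ b) (walk none)) (walk sP)) ,
          λ q → subst (λ v → 0ℤ ≤ℤ lookup v q) (assoc b (k · b) s) (x≥0 (suc q)))
      where
      open CommutativeMonoid (vec-commutativeMonoid n) using (identityʳ)
      walk : ∀ {s} → Span P s → Walk xs i i (b ∙ s)
      walk {s} sP = kleene-sound xs ((b , P) , bP∈ , s , sP , refl)
      eq : (k · b) ∙ b ∙ s ≡ b ∙ (k · b) ∙ s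
      eq = solve 3 (λ x b s → x ⊕ b ⊕ s ⊜ b ⊕ x ⊕ s) refl (k · b) b s
    nonneg-cycle? xs {i} i∈ | no ¬a = no λ (v , w , v≥0) → ¬a (found v≥0 (kleene-complete xs w))
      where
      found : ∀ {v} → (∀ q → 0ℤ ≤ℤ lookup v q) → v ∈ˢ kleene xs i i → Any _ (kleene xs i i)
      found v≥0 ((b , P) , bP∈ , s , sP , refl) =
        lose bP∈ (1ℤ ∷ (b ∙ s) , add (here refl) (counting⁺ sP) ,
          (λ { zero → +≤+ z≤n ; (suc q) → v≥0 q }) , +<+ (s≤s z≤n))

-- Karp-Miller construction

upper-bound : ∀ {n} (f : Fin n → ℕ) → ∃[ b ] (∀ q → f q ≤ b)
upper-bound {zero}  f = 0 , λ ()
upper-bound {suc n} f with upper-bound (f ∘ suc)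
... | b , f≤b = f zero ⊔ b , λ
  { zero → m≤m⊔n (f zero) b ; (suc q) → ≤-trans (f≤b q) (m≤n⊔m (f zero) b) }

fire : ∀ {n} → Transition n → Marking n → Marking n
fire t m q = (m q ∸ pre t q) + post t q

monus-plus : ∀ {a p} b → p ≤ a → ((a ∸ p) + b) + p ≡ a + b
monus-plus {a} {p} b p≤a = begin
  ((a ∸ p) + b) + p   ≡⟨ +-assoc (a ∸ p) b p ⟩
  (a ∸ p) + (b + p)   ≡⟨ cong (λ z → (a ∸ p) + z) (+-comm b p) ⟩
  (a ∸ p) + (p + b)   ≡⟨ +-assoc (a ∸ p) p b ⟨
  ((a ∸ p) + p) + b   ≡⟨ cong (_+ b) (m∸n+n≡m p≤a) ⟩
  a + b               ∎
  where open ≡-Reasoning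

cross : ∀ {x m y m′} → x ≤ m → m + y ≤ m′ + x → y ≤ m′
cross {x} {m} {y} {m′} x≤m le = +-cancelʳ-≤ x y m′ (begin
  y + x   ≤⟨ +-monoʳ-≤ y x≤m ⟩
  y + m   ≡⟨ +-comm y m ⟩
  m + y   ≤⟨ le ⟩
  m′ + x  ∎)
  where open ≤-Reasoning

-- A node (Ω , x) is an ω-marking: it is ω on the places of Ω, where the
-- values of x are irrelevant, and x elsewhere.
Node : ℕ → Set
Node n = Subset n × Marking n

infix 4 _≤[_]_ _⊑_

_≤[_]_ : ∀ {n} → Marking n → Subset n → Marking n → Set
x ≤[ Ω ] y = ∀ q → q ∉ Ω → x q ≤ y q

_≤[_]?_ : ∀ {n} (x : Marking n) Ω y → Dec (x ≤[ Ω ] y)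
x ≤[ Ω ]? y = Fin.all? λ q → ¬? (q ∈? Ω) →-dec (x q ≤? y q)

_⊑_ : ∀ {n} → Node n → Node n → Set
(Ω , x) ⊑ (Ω′ , y) = ∀ q → q ∉ Ω′ → q ∉ Ω × x q ≤ y q

Enabled : ∀ {n} → Transition n → Node n → Set
Enabled t (Ω , x) = pre t ≤[ Ω ] x

fireᴺ : ∀ {n} → Transition n → Node n → Node n
fireᴺ t (Ω , x) = Ω , fire t x

⊑-trans : ∀ {n} {A B C : Node n} → A ⊑ B → B ⊑ C → A ⊑ C
⊑-trans A⊑B B⊑C q q∉ with B⊑C q q∉
... | q∉Ω , y≤z with A⊑B q q∉Ω
...   | q∉Ω′ , x≤y = q∉Ω′ , ≤-trans x≤y y≤z

module KarpMiller {n : ℕ} (N : PetriNet n) where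

  data Reachable : Marking n → Set where
    start : Reachable (m₀ N)
    next  : ∀ {m m′} → Reachable m → Step N m m′ → Reachable m′

  Coverable : Node n → Set
  Coverable (Ω , x) =
    ∀ k → ∃[ m ] Reachable m × x ≤[ Ω ] m × (∀ q → q ∈ Ω → k ≤ m q)

  data Run (Ω : Subset n) (x : Marking n) : Marking n → Set where
    []  : Run Ω x x
    _▷_ : ∀ {y t} → Run Ω x y → t ∈ˡ T N × Enabled t (Ω , y) → Run Ω x (fire t y)

  -- The constant `c` bounds what the run can consume on a place of `Ω`. Off `Ω` the marking changes
  -- by at least y - x, written without subtraction.
  run-lift : ∀ {Ω x y} → Run Ω x y → ∃[ c ] (∀ {k m} → Reachable m → x ≤[ Ω ] m →
    (∀ q → q ∈ Ω → k + c ≤ m q) →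
    ∃[ m′ ] Reachable m′ × (∀ q → q ∉ Ω → m q + y q ≤ m′ q + x q) × (∀ q → q ∈ Ω → k ≤ m′ q))
  run-lift [] = 0 , λ {k} {m} r _ big →
    m , r , (λ _ _ → ≤-refl) , λ q q∈ → subst (_≤ m q) (+-identityʳ k) (big q q∈)
  run-lift {Ω} {x} (_▷_ {y} {t} run (t∈T , en)) with run-lift run | upper-bound (pre t)
  -- The last firing takes at most `β` tokens from each place, so the earlier part of the run is
  -- asked to leave `k + β` on `Ω`.
  ... | c , lift | β , pre≤β = β + c , λ {k} {m} r x≤m big →
    let m′ , r′ , fin , inf = lift {k + β} r x≤m (λ q q∈ → subst (_≤ m q) (sym (+-assoc k β c)) (big q q∈))
        pre≤ : ∀ q → pre t q ≤ m′ q
        pre≤ q = [_,_] (λ q∈ → ≤-trans (pre≤β q) (≤-trans (m≤n+m β k) (inf q q∈)))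
                       (λ q∉ → ≤-trans (en q q∉) (cross (x≤m q q∉) (fin q q∉)))
                       (toSum (q ∈? Ω))
    in fire t m′ , next r′ (t , t∈T , pre≤ , λ _ → refl) ,
       (λ q q∉ → exact (pre≤ q) (en q q∉) (fin q q∉)) ,
       (λ q q∈ → remains (pre≤ q) (pre≤β q) (inf q q∈))
    where
    open ≤-Reasoning
    exact : ∀ {p b m y m′ x} → p ≤ m′ → p ≤ y → m + y ≤ m′ + x →
      m + ((y ∸ p) + b) ≤ ((m′ ∸ p) + b) + x
    exact {p} {b} {m} {y} {m′} {x} p≤m′ p≤y le = +-cancelʳ-≤ p _ _ (begin
      m + ((y ∸ p) + b) + p      ≡⟨ +-assoc m _ p ⟩
      m + ((y ∸ p) + b + p)      ≡⟨ cong (λ z → m + z) (monus-plus b p≤y) ⟩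
      m + (y + b)                ≡⟨ +-assoc m y b ⟨
      m + y + b                  ≤⟨ +-monoˡ-≤ b le ⟩
      m′ + x + b                 ≡⟨ +-assoc m′ x b ⟩
      m′ + (x + b)               ≡⟨ cong (λ z → m′ + z) (+-comm x b) ⟩
      m′ + (b + x)               ≡⟨ +-assoc m′ b x ⟨
      m′ + b + x                 ≡⟨ cong (_+ x) (monus-plus b p≤m′) ⟨
      ((m′ ∸ p) + b) + p + x     ≡⟨ +-assoc _ p x ⟩
      ((m′ ∸ p) + b) + (p + x)   ≡⟨ cong (λ z → ((m′ ∸ p) + b) + z) (+-comm p x) ⟩
      ((m′ ∸ p) + b) + (x + p)   ≡⟨ +-assoc _ x p ⟨
      ((m′ ∸ p) + b) + x + p     ∎)
    remains : ∀ {p b k m′} → p ≤ m′ → p ≤ β → k + β ≤ m′ → k ≤ (m′ ∸ p) + b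
    remains {p} {b} {k} {m′} p≤m′ p≤β inf = +-cancelʳ-≤ p k _ (begin
      k + p               ≤⟨ +-monoʳ-≤ k p≤β ⟩
      k + β               ≤⟨ inf ⟩
      m′                  ≤⟨ m≤m+n m′ b ⟩
      m′ + b              ≡⟨ monus-plus b p≤m′ ⟨
      ((m′ ∸ p) + b) + p  ∎)

  coverable-run : ∀ {Ω x y} → Coverable (Ω , x) → Run Ω x y → Coverable (Ω , y)
  coverable-run cov run k with run-lift run
  ... | c , lift with cov (k + c)
  ...   | m , r , x≤m , big with lift r x≤m big
  ...     | m′ , r′ , fin , inf = m′ , r′ , (λ q q∉ → cross (x≤m q q∉) (fin q q∉)) , inf

  -- Repeats the run `j` times: each round ends above `x` again and gains a token at `q₀`, while its
  -- consumption on `Ω` is paid for in advance by raising `k` to `k + c`.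
  pump : ∀ {Ω x y q₀} → Coverable (Ω , x) → Run Ω x y → x ≤[ Ω ] y → q₀ ∉ Ω → x q₀ < y q₀ →
    ∀ j k → ∃[ m ] Reachable m × x ≤[ Ω ] m × (∀ q → q ∈ Ω → k ≤ m q) × j ≤ m q₀
  pump cov run x≤y q₀∉ x<y zero k with cov k
  ... | m , r , x≤m , big = m , r , x≤m , big , z≤n
  pump {Ω} {x} {y} {q₀} cov run x≤y q₀∉ x<y (suc j) k with run-lift run
  ... | c , lift with pump cov run x≤y q₀∉ x<y j (k + c)
  ...   | m , r , x≤m , big , j≤m with lift r x≤m big
  ...     | m′ , r′ , fin , inf =
    m′ , r′ ,
    (λ q q∉ → ≤-trans (x≤y q q∉) (cross (x≤m q q∉) (fin q q∉))) ,
    inf ,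
    +-cancelʳ-≤ (x q₀) (suc j) (m′ q₀) (begin
      suc j + x q₀    ≡⟨ +-suc j (x q₀) ⟨
      j + suc (x q₀)  ≤⟨ +-mono-≤ j≤m x<y ⟩
      m q₀ + y q₀     ≤⟨ fin q₀ q₀∉ ⟩
      m′ q₀ + x q₀    ∎)
    where open ≤-Reasoning

  -- Pumping yields markings above `x`; one more round carries them above `y` and loses nothing at
  -- `q₀`.
  accelerate : ∀ {Ω x y q₀} → Coverable (Ω , x) → Run Ω x y → x ≤[ Ω ] y → q₀ ∉ Ω → x q₀ < y q₀ →
    Coverable (Ω ∪ ⁅ q₀ ⁆ , y)
  accelerate {Ω} {x} {y} {q₀} cov run x≤y q₀∉ x<y k with run-lift run
  ... | c , lift with pump cov run x≤y q₀∉ x<y k (k + c)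
  ...   | m , r , x≤m , big , k≤m with lift r x≤m big
  ...     | m′ , r′ , fin , inf =
    m′ , r′ , (λ q q∉ → cross (x≤m q (q∉ ∘ p⊆p∪q ⁅ q₀ ⁆)) (fin q (q∉ ∘ p⊆p∪q ⁅ q₀ ⁆))) , k≤m′
    where
    k≤m′ : ∀ q → q ∈ Ω ∪ ⁅ q₀ ⁆ → k ≤ m′ q
    k≤m′ q q∈ with x∈p∪q⁻ Ω ⁅ q₀ ⁆ q∈
    ... | inj₁ q∈Ω = inf q q∈Ω
    ... | inj₂ q∈q₀ with x∈⁅y⁆⇒x≡y q₀ q∈q₀
    ...   | refl = ≤-trans k≤m (+-cancelʳ-≤ (x q₀) (m q₀) (m′ q₀)
      (≤-trans (+-monoʳ-≤ (m q₀) (x≤y q₀ q₀∉)) (fin q₀ q₀∉)))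

  Covered : List (Node n) → List (Node n) → Node n → Set
  Covered L B M = Any (M ⊑_) L ⊎ Any (M ⊑_) B

  -- A finite set of coverable nodes that covers R and is closed under firing,
  -- up to ⊑ and up to nodes of B that are still being explored.
  record Exploration (B R : List (Node n)) : Set where
    field
      nodes     : List (Node n)
      coverable : All Coverable nodes
      roots     : All (Covered nodes B) R
      closed    : All (λ M → ∀ t → t ∈ˡ T N → Enabled t M → Covered nodes B (fireᴺ t M)) nodes
  open Exploration

  exploration-∷ : ∀ {B M R} → Exploration B (M ∷ []) → Exploration B R → Exploration B (M ∷ R)
  exploration-∷ {B} e f = record
    { nodes     = nodes e ++ nodes f
    ; coverable = All.++⁺ (coverable e) (coverable f)
    ; roots     = left (All.head (roots e)) ∷ All.map right (roots f)
    ; closed    = All.++⁺ (All.map (λ c t t∈ en → left (c t t∈ en)) (closed e))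
                          (All.map (λ c t t∈ en → right (c t t∈ en)) (closed f)) }
    where
    left : ∀ {M} → Covered (nodes e) B M → Covered (nodes e ++ nodes f) B M
    left = Sum.map₁ Any.++⁺ˡ
    right : ∀ {M} → Covered (nodes f) B M → Covered (nodes e ++ nodes f) B M
    right = Sum.map₁ (Any.++⁺ʳ (nodes e))

  exploration-all : ∀ {B R} → All (λ M → Exploration B (M ∷ [])) R → Exploration B R
  exploration-all []       = record { nodes = [] ; coverable = [] ; roots = [] ; closed = [] }
  exploration-all (e ∷ es) = exploration-∷ e (exploration-all es)

  enabled? : (t : Transition n) (M : Node n) → Dec (Enabled t M)
  enabled? t (Ω , x) = pre t ≤[ Ω ]? x

  successors : Node n → List (Node n)
  successors M = map (λ t → fireᴺ t M) (filter (λ t → enabled? t M) (T N))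

  -- Once `M` is among the nodes, descendants that were covered by it as an open ancestor are
  -- covered by a node.
  expand : ∀ {B M} → Coverable M → Exploration (M ∷ B) (successors M) → Exploration B (M ∷ [])
  expand {B} {M} cov e = record
    { nodes     = M ∷ nodes e
    ; coverable = cov ∷ coverable e
    ; roots     = inj₁ (here λ _ q∉ → q∉ , ≤-refl) ∷ []
    ; closed    =
        (λ t t∈ en → shift (All.lookup (roots e) (∈-map⁺ _ (∈-filter⁺ (λ t → enabled? t M) t∈ en))))
        ∷ All.map (λ c t t∈ en → shift (c t t∈ en)) (closed e) }
    where
    shift : ∀ {M′} → Covered (nodes e) (M ∷ B) M′ → Covered (M ∷ nodes e) B M′
    shift (inj₁ a)         = inj₁ (there a)
    shift (inj₂ (here p))  = inj₁ (here p)
    shift (inj₂ (there b)) = inj₂ b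

  ≤[]-af : (Ω : Subset n) → AlmostFull (λ x y → x ≤[ Ω ] y)
  ≤[]-af Ω = af-mono (λ x≤y q _ → x≤y q) (dickson-af (λ q x → x q))

  -- H lists the ancestors of x that have the same set Ω of ω-places; it is
  -- forgotten when x is accelerated, which happens at most d times.
  explore : ∀ d {Ω x H} → n ≤ card Ω + d → Barred (λ x y → x ≤[ Ω ] y) H →
    ¬ Good (λ x y → x ≤[ Ω ] y) H → All (λ h → Coverable (Ω , h) × Run Ω h x) H →
    Coverable (Ω , x) → Exploration (map (Ω ,_) H) ((Ω , x) ∷ [])
  explore d size (good g) bad hist cov = contradiction g bad
  explore d {Ω} {x} {H} size (grow bar) bad hist cov with Any.any? (λ h → h ≤[ Ω ]? x) H
  ... | no ¬h≤x = expand cov (exploration-all (All.tabulate child))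
    where
    child : ∀ {M} → M ∈ˡ successors (Ω , x) → Exploration (map (Ω ,_) (x ∷ H)) (M ∷ [])
    child M∈ with ∈-map⁻ (λ t → fireᴺ t (Ω , x)) M∈
    ... | t , t∈ , refl =
      let t∈T , en = ∈-filter⁻ (λ t → enabled? t (Ω , x)) {xs = T N} t∈ in
      explore d size (bar x) (λ { (hit h≤x) → ¬h≤x h≤x ; (skip g) → bad g })
        ((cov , [] ▷ (t∈T , en)) ∷ All.map (λ (c , r) → c , r ▷ (t∈T , en)) hist)
        (coverable-run cov ([] ▷ (t∈T , en)))
  ... | yes some with find some
  ...   | h , h∈H , h≤x with Fin.any? (λ q → ¬? (q ∈? Ω) ×-dec (h q <? x q))
  -- Here `x` and `h` agree off `Ω`, so the ancestor `h` covers `x` and the branch stops.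
  ...     | no ¬h<x = record
    { nodes = [] ; coverable = [] ; closed = []
    ; roots = inj₂ (lose (∈-map⁺ (Ω ,_) h∈H) λ q q∉ → q∉ , ≮⇒≥ λ h<x → ¬h<x (q , q∉ , h<x)) ∷ [] }
  -- With no accelerations left, `Ω` already has `n` elements, so no place `q ∉ Ω` can remain.
  explore zero {Ω} size (grow bar) bad hist cov | yes _ | h , h∈H , h≤x | yes (q , q∉ , h<x) =
    contradiction
      (≤-trans (p⊂q⇒∣p∣<∣q∣ (p⊆p∪q ⁅ q ⁆ , q , q⊆p∪q Ω ⁅ q ⁆ (x∈⁅x⁆ q) , q∉))
        (≤-trans (∣p∣≤n (Ω ∪ ⁅ q ⁆)) (≤-trans size (≤-reflexive (+-identityʳ (card Ω))))))
      (<-irrefl refl)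
  explore (suc d) {Ω} {x} {H} size (grow bar) bad hist cov | yes _ | h , h∈H , h≤x | yes (q , q∉ , h<x) = record
    { nodes     = nodes e
    ; coverable = coverable e
    ; roots     = unaccelerate (All.head (roots e)) ∷ []
    ; closed    = All.map (λ c t t∈ en → Sum.map₂ (λ ()) (c t t∈ en)) (closed e) }
    where
    Ω′ : Subset n
    Ω′ = Ω ∪ ⁅ q ⁆
    size′ : n ≤ card Ω′ + d
    size′ = begin
      n              ≤⟨ size ⟩
      card Ω + suc d  ≡⟨ +-suc (card Ω) d ⟩
      suc (card Ω) + d  ≤⟨ +-monoˡ-≤ d (p⊂q⇒∣p∣<∣q∣ (p⊆p∪q ⁅ q ⁆ , q , q⊆p∪q Ω ⁅ q ⁆ (x∈⁅x⁆ q) , q∉)) ⟩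
      card Ω′ + d     ∎
      where open ≤-Reasoning
    -- The accelerated node is explored with no open ancestors, so its result is closed by itself
    -- and the current branch can be abandoned.
    e : Exploration [] ((Ω′ , x) ∷ [])
    e = explore d size′ (af⇒barred (≤[]-af Ω′)) (λ ()) []
          (accelerate (proj₁ (All.lookup hist h∈H)) (proj₂ (All.lookup hist h∈H)) h≤x q∉ h<x)
    unaccelerate : Covered (nodes e) [] (Ω′ , x) → Covered (nodes e) (map (Ω ,_) H) (Ω , x)
    unaccelerate (inj₁ a) =
      inj₁ (Any.map (λ {M} → ⊑-trans {A = Ω , x} {Ω′ , x} {M} λ _ q∉ → q∉ ∘ p⊆p∪q ⁅ q ⁆ , ≤-refl) a)

  coverabilitySet : Exploration [] ((⊥ , m₀ N) ∷ [])
  coverabilitySet = explore n (m≤n+m n (card {n} ⊥)) (af⇒barred (≤[]-af ⊥)) (λ ()) []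
    λ k → m₀ N , start , (λ _ _ → ≤-refl) , λ q q∈ → contradiction q∈ ∉⊥

-- Cycles of the coverability graph

-- The pigeonhole principle from `≤-af`: i ≤ j together with k - i ≤ k - j forces i = j.
Fin-≡-af : ∀ {k} → AlmostFull {Fin k} _≡_
Fin-≡-af {k} =
  af-mono (λ {i} {j} (i≤j , k∸i≤k∸j) →
      Fin.toℕ-injective (≤-antisym i≤j
        (≮⇒≥ λ i<j → <⇒≱ (∸-monoʳ-< i<j (<⇒≤ (Fin.toℕ<n j))) k∸i≤k∸j)))
    (af-∩ (af-comap toℕ ≤-af) (af-comap (λ i → k ∸ toℕ i) ≤-af))

+ℤ-cancelʳ-≤ : ∀ k i j → i +ℤ k ≤ℤ j +ℤ k → i ≤ℤ j
+ℤ-cancelʳ-≤ k i j le = subst₂ _≤ℤ_ (cancel i) (cancel j) (ℤ.+-monoˡ-≤ (- k) le)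
  where
  cancel : ∀ i → i +ℤ k -ℤ k ≡ i
  cancel i = trans (ℤ.+-assoc i k (- k)) (trans (cong (i +ℤ_) (ℤ.+-inverseʳ k)) (ℤ.+-identityʳ i))

pre-bound : ∀ {n} (ts : List (Transition n)) → ∃[ β ] (∀ {t} → t ∈ˡ ts → ∀ q → pre t q ≤ β)
pre-bound []       = 0 , λ ()
pre-bound (t ∷ ts) with upper-bound (pre t) | pre-bound ts
... | b , t≤b | c , ts≤c = b ⊔ c , λ
  { (here refl) q → ≤-trans (t≤b q) (m≤m⊔n b c)
  ; (there t∈) q → ≤-trans (ts≤c t∈ q) (m≤n⊔m b c) }

module Cycles {n : ℕ} (N : PetriNet n) (V : Subset n) (p : Fin n) where
  open KarpMiller N
  open Exploration

  effect : Transition n → Vec ℤ n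
  effect t = tabulate λ q → + post t q -ℤ + pre t q

  fire-effect : ∀ t m {q} → pre t q ≤ m q → + fire t m q ≡ + m q +ℤ lookup (effect t) q
  fire-effect t m {q} p≤m = begin
    + (m q ∸ a) +ℤ + b            ≡⟨ cong (_+ℤ + b) (ℤ.⊖-≥ p≤m) ⟨
    (m q ⊖ a) +ℤ + b ≡⟨ cong (_+ℤ + b) (ℤ.m-n≡m⊖n (m q) a) ⟨
    (+ m q -ℤ + a) +ℤ + b         ≡⟨ ℤ.+-assoc (+ m q) (- (+ a)) (+ b) ⟩
    + m q +ℤ (- (+ a) +ℤ + b)     ≡⟨ cong (+ m q +ℤ_) (ℤ.+-comm (- (+ a)) (+ b)) ⟩
    + m q +ℤ (+ b -ℤ + a)         ≡⟨ cong (+ m q +ℤ_) (Vec.lookup∘tabulate _ q) ⟨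
    + m q +ℤ lookup (effect t) q  ∎
    where
    open ≡-Reasoning
    a b : ℕ
    a = pre t q
    b = post t q

  Safe : Marking n → Set
  Safe m = (∃[ v ] (v ∈ V × 1 ≤ m v)) × 1 ≤ m p

  Safeᴺ : Node n → Set
  Safeᴺ (Ω , x) = (∃[ v ] (v ∈ V × (v ∉ Ω → 1 ≤ x v))) × (p ∉ Ω → 1 ≤ x p)

  safeᴺ? : ∀ M → Dec (Safeᴺ M)
  safeᴺ? (Ω , x) =
    Fin.any? (λ v → (v ∈? V) ×-dec (¬? (v ∈? Ω) →-dec (1 ≤? x v))) ×-dec (¬? (p ∈? Ω) →-dec (1 ≤? x p))

  _⊑?_ : (A B : Node n) → Dec (A ⊑ B)
  (Ω , x) ⊑? (Ω′ , y) =
    Fin.all? λ q → ¬? (q ∈? Ω′) →-dec (¬? (q ∈? Ω) ×-dec (x q ≤? y q))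

  Edge : Node n → Node n → Transition n → Set
  Edge A B t = Safeᴺ A × Enabled t A × fireᴺ t A ⊑ B

  edge? : ∀ A B t → Dec (Edge A B t)
  edge? A B t = safeᴺ? A ×-dec (enabled? t A ×-dec (fireᴺ t A ⊑? B))

  edges : Node n → Node n → List (Vec ℤ n)
  edges A B = map effect (filter (edge? A B) (T N))

  edges⁻ : ∀ {A B v} → v ∈ˡ edges A B → ∃[ t ] t ∈ˡ T N × Edge A B t × v ≡ effect t
  edges⁻ {A} {B} v∈ with ∈-map⁻ effect v∈
  ... | t , t∈ , eq = let t∈T , e = ∈-filter⁻ (edge? A B) {xs = T N} t∈ in t , t∈T , e , eq

  open Kleene edges

  record RunFrom (m : Marking n) : Set where
    field
      run       : ℕ → Marking n
      initial   : run 0 ≡ m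
      steps     : ∀ j → Step N (run j) (run (suc j))
      threshold : ℕ
      safe      : ∀ j → threshold ≤ j → Safe (run j)

  prepend : ∀ {m m′} → Step N m m′ → RunFrom m′ → RunFrom m
  prepend {m} s r = record
    { run = λ { zero → m ; (suc j) → run j } ; initial = refl
    ; steps = λ { zero → subst (Step N m) (sym initial) s ; (suc j) → steps j }
    ; threshold = suc threshold
    ; safe = λ { (suc j) (s≤s le) → safe j le } }
    where open RunFrom r

  from-start : ∀ {m} → Reachable m → RunFrom m → InfinitelyVisits N V p
  from-start start r = run , (λ q → cong (λ m → m q) initial) , steps , threshold , safe
    where open RunFrom r
  from-start (next r s) ρ = from-start r (prepend s ρ)

  -- Around a cycle at u with nonnegative effect, the sum of the slacks of
  -- the edges outside Ω is nonpositive, hence the cycle is exact there; on Ω it needs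
  -- only a bounded number of tokens. So it can be repeated forever from any large enough m⋆.
  module Unroll (L : List (Node n)) (Ω : Subset n) (u : Marking n) {total : Vec ℤ n}
    (cycle : Walk L (Ω , u) (Ω , u) total) (total≥0 : ∀ q → 0ℤ ≤ℤ lookup total q) where

    private
      U : Node n
      U = Ω , u

    -- Each `⊑` along the walk can only raise values and add ω-places. So a place that is finite at
    -- the end was finite throughout, and its final value dominates the start plus the weight.
    walk-bound : ∀ {Ω′ x v} → Walk L (Ω′ , x) U v → ∀ q → q ∉ Ω → q ∉ Ω′ × + x q +ℤ lookup v q ≤ℤ + u q
    walk-bound {x = x} (edge e) q q∉ with edges⁻ e
    ... | t , _ , (_ , en , ⊑U) , refl with ⊑U q q∉
    ...   | q∉′ , fx≤u = q∉′ , subst (_≤ℤ + u q) (fire-effect t x (en q q∉′)) (+≤+ fx≤u)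
    walk-bound {x = x} (step {k = _ , y} {w = w} e _ π) q q∉ with walk-bound π q q∉ | edges⁻ e
    ... | q∉y , y+w≤u | t , _ , (_ , en , ⊑Y) , refl with ⊑Y q q∉y
    ...   | q∉′ , fx≤y = q∉′ , (begin
      + x q +ℤ lookup (effect t ∙ w) q             ≡⟨ cong (+ x q +ℤ_) (lookup-∙ (effect t) w q) ⟩
      + x q +ℤ (lookup (effect t) q +ℤ lookup w q) ≡⟨ ℤ.+-assoc (+ x q) (lookup (effect t) q) (lookup w q) ⟨
      + x q +ℤ lookup (effect t) q +ℤ lookup w q   ≡⟨ cong (_+ℤ lookup w q) (fire-effect t x (en q q∉′)) ⟨
      + fire t x q +ℤ lookup w q                   ≤⟨ ℤ.+-monoˡ-≤ (lookup w q) (+≤+ fx≤y) ⟩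
      + y q +ℤ lookup w q                          ≤⟨ y+w≤u ⟩
      + u q                                        ∎)
      where open ℤ.≤-Reasoning

    β : ℕ
    β = proj₁ (pre-bound (T N))

    -- If weight `v` is still to come and the cycle is to end with at least `k` tokens, then at
    -- least `suc β` are present now: `β` for any firing, and one so that the place is marked even
    -- when nothing is consumed.
    Affords : ℕ → Vec ℤ n → Set
    Affords k v = ∀ q → + suc β +ℤ lookup v q ≤ℤ + k

    Ample : ℕ → ∀ {M v} → Walk L M U v → Set
    Ample k {v = v} (edge _)     = Affords k v
    Ample k {v = v} (step _ _ π) = Affords k v × Ample k π

    affords : ∀ v → ∃[ k ] Affords k v
    affords v with upper-bound (λ q → ∣ + suc β +ℤ lookup v q ∣ℤ)
    ... | k , ≤k = k , λ q → ℤ.≤-trans (i≤+∣i∣ _) (+≤+ (≤k q))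
      where
      i≤+∣i∣ : ∀ i → i ≤ℤ + ∣ i ∣ℤ
      i≤+∣i∣ (+ _)    = ℤ.≤-refl
      i≤+∣i∣ -[1+ _ ] = -≤+

    affords-mono : ∀ {k l v} → k ≤ l → Affords k v → Affords l v
    affords-mono k≤l a q = ℤ.≤-trans (a q) (+≤+ k≤l)

    ample-mono : ∀ {k l M v} → k ≤ l → (π : Walk L M U v) → Ample k π → Ample l π
    ample-mono {v = v} k≤l (edge _)     a        = affords-mono {v = v} k≤l a
    ample-mono {v = v} k≤l (step _ _ π) (a , as) = affords-mono {v = v} k≤l a , ample-mono k≤l π as

    ample : ∀ {M v} (π : Walk L M U v) → ∃[ k ] Ample k π
    ample {v = v} (edge _)     = affords v
    ample {v = v} (step _ _ π) with affords v | ample π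
    ... | k , a | l , as =
      k ⊔ l , affords-mono {v = v} (m≤m⊔n k l) a , ample-mono (m≤n⊔m k l) π as

    module _ {k} (cycle-ample : Ample k cycle) {m⋆ : Marking n}
      (u≤m⋆ : u ≤[ Ω ] m⋆) (k≤m⋆ : ∀ q → q ∈ Ω → k ≤ m⋆ q) where

      -- The invariant `enough` promises that completing the rest of the cycle leads back to at
      -- least `m⋆`.
      record State : Set where
        constructor state
        field
          {node}  : Node n
          {rest}  : Vec ℤ n
          path    : Walk L node U rest
          affordable : Ample k path
          marking : Marking n
          enough  : ∀ q → + m⋆ q ≤ℤ + marking q +ℤ lookup rest q
      open State

      -- Off `Ω`, the chain x + v ≤ u ≤ m⋆ ≤ m + v cancels to x ≤ m, so `m` inherits enabledness and
      -- safety from the node. On `Ω`, `Affords` provides the tokens.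
      simulates : ∀ {A B t v m} → t ∈ˡ T N → Edge A B t → Affords k v → (∀ q → + m⋆ q ≤ℤ + m q +ℤ lookup v q) →
        (∀ q → q ∉ Ω → q ∉ proj₁ A × + proj₂ A q +ℤ lookup v q ≤ℤ + u q) →
        Safe m × (∀ q → pre t q ≤ m q)
      simulates {Ωᴬ , x} {t = t} {v} {m} t∈T (((s , s∈V , safe-s) , safe-p) , en , _) aff m⋆≤ bound =
        ((s , s∈V , positive s safe-s) , positive p safe-p) , pre≤
        where
        open ℤ.≤-Reasoning
        on-Ω : ∀ q → q ∈ Ω → suc (pre t q) ≤ m q
        on-Ω q q∈ = ℤ.drop‿+≤+ (+ℤ-cancelʳ-≤ (lookup v q) (+ suc (pre t q)) (+ m q) (begin
          + suc (pre t q) +ℤ lookup v q ≤⟨ ℤ.+-monoˡ-≤ (lookup v q) (+≤+ (s≤s (proj₂ (pre-bound (T N)) t∈T q))) ⟩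
          + suc β +ℤ lookup v q         ≤⟨ aff q ⟩
          + k                           ≤⟨ +≤+ (k≤m⋆ q q∈) ⟩
          + m⋆ q                        ≤⟨ m⋆≤ q ⟩
          + m q +ℤ lookup v q           ∎))
        off-Ω : ∀ q → q ∉ Ω → q ∉ Ωᴬ × x q ≤ m q
        off-Ω q q∉ = proj₁ (bound q q∉) , ℤ.drop‿+≤+ (+ℤ-cancelʳ-≤ (lookup v q) (+ x q) (+ m q) (begin
          + x q +ℤ lookup v q ≤⟨ proj₂ (bound q q∉) ⟩
          + u q               ≤⟨ +≤+ (u≤m⋆ q q∉) ⟩
          + m⋆ q              ≤⟨ m⋆≤ q ⟩
          + m q +ℤ lookup v q ∎))
        positive : ∀ q → (q ∉ Ωᴬ → 1 ≤ x q) → 1 ≤ m q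
        positive q 1≤x with q ∈? Ω
        ... | yes q∈ = ≤-trans (s≤s z≤n) (on-Ω q q∈)
        ... | no  q∉ = let q∉′ , x≤m = off-Ω q q∉ in ≤-trans (1≤x q∉′) x≤m
        pre≤ : ∀ q → pre t q ≤ m q
        pre≤ q with q ∈? Ω
        ... | yes q∈ = <⇒≤ (on-Ω q q∈)
        ... | no  q∉ = let q∉′ , x≤m = off-Ω q q∉ in ≤-trans (en q q∉′) x≤m

      advance : (s : State) → Safe (marking s) × ∃[ s′ ] Step N (marking s) (marking s′)
      advance (state {rest = v} π@(edge e) am m m⋆≤) with edges⁻ e
      ... | t , t∈T , E , refl
        with simulates {v = v} {m} t∈T E am m⋆≤ (walk-bound π)
      ...   | safe , pre≤ =
        -- The cycle is complete and starts over; the invariant is restored because `total` is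
        -- nonnegative.
        safe , state cycle cycle-ample (fire t m) enough′ , t , t∈T , pre≤ , λ _ → refl
        where
        enough′ : ∀ q → + m⋆ q ≤ℤ + fire t m q +ℤ lookup total q
        enough′ q = begin
          + m⋆ q                              ≤⟨ m⋆≤ q ⟩
          + m q +ℤ lookup (effect t) q        ≡⟨ fire-effect t m (pre≤ q) ⟨
          + fire t m q                        ≡⟨ ℤ.+-identityʳ _ ⟨
          + fire t m q +ℤ 0ℤ                  ≤⟨ ℤ.+-monoʳ-≤ (+ fire t m q) (total≥0 q) ⟩
          + fire t m q +ℤ lookup total q      ∎
          where open ℤ.≤-Reasoning
      advance (state {rest = v} π@(step {w = w} e _ π′) am m m⋆≤) with edges⁻ e
      ... | t , t∈T , E , refl
        with simulates {v = v} {m} t∈T E (proj₁ am) m⋆≤ (walk-bound π)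
      ...   | safe , pre≤ =
        safe , state π′ (proj₂ am) (fire t m) enough′ , t , t∈T , pre≤ , λ _ → refl
        where
        enough′ : ∀ q → + m⋆ q ≤ℤ + fire t m q +ℤ lookup w q
        enough′ q = begin
          + m⋆ q                                       ≤⟨ m⋆≤ q ⟩
          + m q +ℤ lookup (effect t ∙ w) q             ≡⟨ cong (+ m q +ℤ_) (lookup-∙ (effect t) w q) ⟩
          + m q +ℤ (lookup (effect t) q +ℤ lookup w q) ≡⟨ ℤ.+-assoc (+ m q) (lookup (effect t) q) (lookup w q) ⟨
          + m q +ℤ lookup (effect t) q +ℤ lookup w q   ≡⟨ cong (_+ℤ lookup w q) (fire-effect t m (pre≤ q)) ⟨
          + fire t m q +ℤ lookup w q                   ∎
          where open ℤ.≤-Reasoning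

      unroll : RunFrom m⋆
      unroll = record
        { run = marking ∘ states ; initial = refl
        ; steps = λ j → proj₂ (proj₂ (advance (states j)))
        ; threshold = 0 ; safe = λ j _ → proj₁ (advance (states j)) }
        where
        states : ℕ → State
        states zero    = state cycle cycle-ample m⋆ λ q →
          subst (_≤ℤ + m⋆ q +ℤ lookup total q) (ℤ.+-identityʳ (+ m⋆ q)) (ℤ.+-monoʳ-≤ (+ m⋆ q) (total≥0 q))
        states (suc j) = proj₁ (proj₂ (advance (states j)))

    cycle⇒visits : Coverable U → InfinitelyVisits N V p
    cycle⇒visits cov with ample cycle
    ... | k , am with cov k
    ...   | m⋆ , r , u≤m⋆ , k≤m⋆ = from-start r (unroll am u≤m⋆ k≤m⋆)

  -- Equivalence of infinite visits and nonnegative cycles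

  module Decision (e : Exploration [] ((⊥ , m₀ N) ∷ [])) where

    L : List (Node n)
    L = nodes e

    -- Putting `M` in front of `L` permits concatenating cycles at `M` without a proof that `M`
    -- belongs to `L`, which `any?` does not pass to its predicate.
    Cycle : Node n → Set
    Cycle M = ∃[ v ] Walk (M ∷ L) M M v × (∀ q → 0ℤ ≤ℤ lookup v q)

    covered-by-L : ∀ {M} → Covered L [] M → ∃[ M′ ] M′ ∈ˡ L × M ⊑ M′
    covered-by-L (inj₁ a) = find a

    module Trace (ms : ℕ → Marking n) (ms₀ : ∀ q → ms 0 q ≡ m₀ N q)
      (steps : ∀ j → Step N (ms j) (ms (suc j)))
      (i : ℕ) (safe : ∀ j → i ≤ j → Safe (ms j)) where

      record Above (m : Marking n) : Set where
        constructor above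
        field
          node  : Node n
          node∈ : node ∈ˡ L
          m≤    : m ≤[ proj₁ node ] proj₂ node
      open Above

      follow : ∀ {m m′} → Step N m m′ → (a : Above m) → ∃[ b ]
        (∃[ t ] t ∈ˡ T N × Enabled t (node a) × fireᴺ t (node a) ⊑ node {m′} b × (∀ q → pre t q ≤ m q × m′ q ≡ fire t m q))
      follow (t , t∈T , pre≤ , m′≡) (above (Ω , x) M∈ m≤)
        with covered-by-L (All.lookup (closed e) M∈ t t∈T λ q q∉ → ≤-trans (pre≤ q) (m≤ q q∉))
      ... | M′ , M′∈ , f⊑ =
        above M′ M′∈ (λ q q∉ → let q∉Ω , f≤ = f⊑ q q∉ in
          ≤-trans (≤-reflexive (m′≡ q)) (≤-trans (+-monoˡ-≤ (post t q) (∸-monoˡ-≤ (pre t q) (m≤ q q∉Ω))) f≤)) ,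
        t , t∈T , (λ q q∉ → ≤-trans (pre≤ q) (m≤ q q∉)) , f⊑ , λ q → pre≤ q , m′≡ q

      trace : ∀ j → Above (ms j)
      trace zero with covered-by-L (All.head (roots e))
      ... | M , M∈ , m₀⊑ = above M M∈ λ q q∉ → subst (_≤ _) (sym (ms₀ q)) (proj₂ (m₀⊑ q q∉))
      trace (suc j) = proj₁ (follow (steps j) (trace j))

      safeᴺ : ∀ {m} (a : Above m) → Safe m → Safeᴺ (node a)
      safeᴺ a ((v , v∈V , 1≤v) , 1≤p) =
        (v , v∈V , λ v∉ → ≤-trans 1≤v (m≤ a v v∉)) , λ p∉ → ≤-trans 1≤p (m≤ a p p∉)

      trace-edge : ∀ j → i ≤ j → ∃[ v ] v ∈ˡ edges (node (trace j)) (node (trace (suc j))) ×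
        (∀ q → + ms (suc j) q ≡ + ms j q +ℤ lookup v q)
      trace-edge j i≤j =
        let b , t , t∈T , en , f⊑ , fires = follow (steps j) (trace j) in
        effect t ,
        ∈-map⁺ effect (∈-filter⁺ (edge? (node (trace j)) (node b)) t∈T
          (safeᴺ (trace j) (safe j i≤j) , en , f⊑)) ,
        λ q → trans (cong +_ (proj₂ (fires q))) (fire-effect t (ms j) (proj₁ (fires q)))

      trace-walk : ∀ j → i ≤ j → ∀ d → ∃[ v ] Walk L (node (trace j)) (node (trace (suc d + j))) v ×
        (∀ q → + ms (suc d + j) q ≡ + ms j q +ℤ lookup v q)
      trace-walk j i≤j zero =
        let v , x , eq = trace-edge j i≤j in v , edge x , eq
      trace-walk j i≤j (suc d) =
        let v , π , eq  = trace-walk j i≤j d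
            w , x , eq′ = trace-edge (suc d + j) (≤-trans i≤j (m≤n+m j (suc d))) in
        v ∙ w , walk-∙ π (node∈ (trace (suc d + j))) (edge x) , λ q → (begin
          + ms (suc (suc d + j)) q                   ≡⟨ eq′ q ⟩
          + ms (suc d + j) q +ℤ lookup w q           ≡⟨ cong (_+ℤ lookup w q) (eq q) ⟩
          + ms j q +ℤ lookup v q +ℤ lookup w q         ≡⟨ ℤ.+-assoc (+ ms j q) (lookup v q) (lookup w q) ⟩
          + ms j q +ℤ (lookup v q +ℤ lookup w q)       ≡⟨ cong (+ ms j q +ℤ_) (lookup-∙ v w q) ⟨
          + ms j q +ℤ lookup (v ∙ w) q                 ∎)
        where open ≡-Reasoning

      -- Recurrence of nodes is detected through their positions in `L`, which range over a finite
      -- type.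
      same-node : ∀ {m m′} (a : Above m) (b : Above m′) → index (node∈ a) ≡ index (node∈ b) → node a ≡ node b
      same-node a b eq =
        trans (Any.lookup-index (node∈ a))
          (trans (cong (List.lookup L) eq) (sym (Any.lookup-index (node∈ b))))

      shift : ∀ {k l} → k < l → l + i ≡ suc (l ∸ suc k) + (k + i)
      shift {k} {l} k<l = begin
        l + i                            ≡⟨ cong (_+ i) (m∸n+n≡m k<l) ⟨
        (l ∸ suc k) + suc k + i        ≡⟨ cong (_+ i) (+-suc (l ∸ suc k) k) ⟩
        suc (l ∸ suc k) + k + i        ≡⟨ +-assoc (suc (l ∸ suc k)) k i ⟩
        suc (l ∸ suc k) + (k + i)      ∎
        where open ≡-Reasoning

      -- Indices are shifted by `i` so that the whole segment lies where all markings are safe and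
      -- every firing is an edge.
      Recurrence : Set
      Recurrence = ∃[ k ] ∃[ l ] k < l ×
        index (node∈ (trace (k + i))) ≡ index (node∈ (trace (l + i))) ×
        (∀ q → ms (k + i) q ≤ ms (l + i) q)

      recurrence : Recurrence
      recurrence = af-sequence
        (af-∩ (af-comap (λ k → index (node∈ (trace (k + i)))) Fin-≡-af)
              (dickson-af (λ q k → ms (k + i) q))) (λ k → k)

      nonneg-effect : ∀ {j l} {v : Vec ℤ n} → (∀ q → + ms l q ≡ + ms j q +ℤ lookup v q) →
        (∀ q → ms j q ≤ ms l q) → ∀ q → 0ℤ ≤ℤ lookup v q
      nonneg-effect {j} {v = v} eq ms≤ q = +ℤ-cancelʳ-≤ (+ ms j q) 0ℤ (lookup v q)
        (subst (+ ms j q ≤ℤ_) (trans (eq q) (ℤ.+-comm (+ ms j q) (lookup v q))) (+≤+ (ms≤ q)))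

      recurrence⇒cycle : Recurrence → Any Cycle L
      recurrence⇒cycle (k , l , k<l , same , ms≤) =
        close (trace-walk (k + i) (m≤n+m i k) (l ∸ suc k))
        where
        close : ∃[ v ] Walk L (node (trace (k + i))) (node (trace (suc (l ∸ suc k) + (k + i)))) v ×
            (∀ q → + ms (suc (l ∸ suc k) + (k + i)) q ≡ + ms (k + i) q +ℤ lookup v q) →
          Any Cycle L
        close (v , π , eq) = lose (node∈ (trace (k + i)))
          (v ,
           walk-⊆ there (subst (λ M → Walk L _ M v)
             (trans (cong (λ j → node (trace j)) (sym (shift k<l)))
               (sym (same-node (trace (k + i)) (trace (l + i)) same))) π) ,
           nonneg-effect {k + i} {suc (l ∸ suc k) + (k + i)} {v} eq
             (λ q → subst (λ j → ms (k + i) q ≤ ms j q) (shift k<l) (ms≤ q)))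

    cycle⇒infinitelyVisits : Any Cycle L → InfinitelyVisits N V p
    cycle⇒infinitelyVisits a with find a
    ... | (Ω , u) , U∈ , v , π , v≥0 =
      Unroll.cycle⇒visits ((Ω , u) ∷ L) Ω u π v≥0 (All.lookup (coverable e) U∈)

    infinitelyVisits⇒cycle : InfinitelyVisits N V p → Any Cycle L
    infinitelyVisits⇒cycle (ms , ms₀ , steps , i , safe) = recurrence⇒cycle recurrence
      where open Trace ms ms₀ steps i safe

    any-cycle? : Dec (Any Cycle L)
    any-cycle? = Any.any? (λ M → nonneg-cycle? edges (M ∷ L) (here refl)) L

theorem5p13 : (n : ℕ) (N : PetriNet n) (V : Subset n) (p : Fin n) →
    Dec (InfinitelyVisits N V p)
theorem5p13 n N V p = map′ cycle⇒infinitelyVisits infinitelyVisits⇒cycle any-cycle?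
  where
  open Cycles N V p
  open Decision (KarpMiller.coverabilitySet N)
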